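{- There is a constant $c>0$ such that for infinitely many $n\in\mathbb N$ there are a bin packing instance with item sizes $1\ge s_1\ge s_2\ge\dots\ge s_n>0$ and a feasible fractional solution $y\in[0,1]^{\mathcal P}$ of (LP) for which the following holds. Let $x\in\mathbb Z_{\ge 0}^{\mathcal P}$ and $D\subseteq[n]$ (the items not covered by $x$) be such that (i) $\mathrm{supp}(x)\subseteq\mathrm{supp}(y)$, and (ii) there is a map $\sigma:[n]\setminus D\to[n]$ with $\sigma(i)\le i$ for all $i\in[n]\setminus D$ and $\sum_{p\in\mathcal P:\, i\in p} x_p\ge|\sigma^{ -1}(i)|$ for all $i\in\{1,\dots,n\}$. Then $$\mathbf 1^Tx+2\sum_{i\in D}s_i\ \ge\ \mathbf 1^Ty+c\,\log^2 n .$$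
   Context: For item sizes $s=(s_1,\dots,s_n)\in[0,1]^n$, let $\mathcal P=\{p\in\{0,1\}^n : s^Tp\le 1\}$ be the set of feasible patterns; a pattern $p$ is identified with the set of items $\{i : p_i=1\}$, so $i\in p$ means $p_i=1$. The linear program (LP) is $$\min \sum_{p\in\mathcal P} x_p \quad\text{s.t.}\quad \sum_{p\in\mathcal P} p\, x_p \ge \mathbf 1,\qquad x_p\ge 0 \ \ \forall p\in\mathcal P,$$ with the vector inequality componentwise; a vector $y$ is a feasible fractional solution if it satisfies these constraints. Here $\mathbf 1$ denotes an all-ones vector of suitable dimension (so $\mathbf 1^Tx=\sum_{p}x_p$), $[n]=\{1,\dots,n\}$, and $\mathrm{supp}(x)=\{p\in\mathcal P: x_p\neq 0\}$. -}

module Defs where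

open import Data.Fin.Base as Fin using (Fin)
import Data.Fin.Properties as Fin
open import Data.Fin.Subset using (Subset; inside; outside; _∈_; _∉_)
open import Data.Fin.Subset.Properties using (_∈?_)
open import Data.Integer.Base using (+_)
open import Data.Irrelevant using ([_])
open import Data.List.Base using (List; []; _∷_; _++_; map; mapMaybe; filter; foldr; length; allFin)
open import Data.Maybe.Base using (Maybe; just; nothing)
open import Data.Nat.Base as ℕ using (ℕ; zero; suc; _^_)
open import Data.Rational.Base using (ℚ; 0ℚ; 1ℚ; _+_; _*_; _≤_; _<_; _/_)
open import Data.Rational.Properties using (_≤?_)
open import Data.Refinement using (Refinement; Refinement-syntax; value; _,_)
open import Data.Vec.Base using ([]; _∷_)
open import Relation.Binary.PropositionalEquality using (_≢_)
open import Relation.Nullary using (yes; no; ¬?)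
open import Relation.Unary using (Pred; Decidable)
open import Level using (0ℓ)

-- Index order agrees with the order of Fin n, so Fin.zero is the largest item.
record Instance (n : ℕ) : Set where
  field
    size          : Fin n → ℚ
    size-positive : ∀ i → 0ℚ < size i
    size≤1        : ∀ i → size i ≤ 1ℚ
    nonincreasing : ∀ {i j} → i Fin.≤ j → size j ≤ size i

sumℚ : List ℚ → ℚ
sumℚ = foldr _+_ 0ℚ

comprehension : {A : Set} {P : Pred A 0ℓ} → Decidable P → List A → List [ a ∈ A ∣ P a ]
comprehension {A} {P} P? = mapMaybe check
  where
  check : A → Maybe [ a ∈ A ∣ P a ]
  check a with P? a
  ... | yes pa = just (a , [ pa ])
  ... | no  _  = nothing

subsets : ∀ n → List (Subset n)
subsets zero    = [] ∷ []
subsets (suc n) = map (outside ∷_) (subsets n) ++ map (inside ∷_) (subsets n)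

module _ {n : ℕ} where

  Complement : Subset n → Set
  Complement D = [ j ∈ Fin n ∣ j ∉ D ]

  complement : (D : Subset n) → List (Complement D)
  complement D = comprehension (λ j → ¬? (j ∈? D)) (allFin n)

  ∣_⁻¹_∣ : {D : Subset n} → (Complement D → Fin n) → Fin n → ℕ
  ∣_⁻¹_∣ {D} σ i = length (filter (λ j → σ j Fin.≟ i) (complement D))

module BinPacking {n : ℕ} (I : Instance n) where
  open Instance I public

  -- Σ_{i ∈ p} sᵢ, that is, sᵀp for the indicator vector p.
  totalSize : Subset n → ℚ
  totalSize p = sumℚ (map size (filter (_∈? p) (allFin n)))

  Feasible : Subset n → Set
  Feasible p = totalSize p ≤ 1ℚ

  Pattern : Set
  Pattern = [ p ∈ Subset n ∣ Feasible p ]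

  patterns : List Pattern
  patterns = comprehension (λ p → totalSize p ≤? 1ℚ) (subsets n)

  patternsWith : Fin n → List Pattern
  patternsWith i = filter (λ p → i ∈? value p) patterns

  record FractionalSolution (y : Pattern → ℚ) : Set where
    field
      nonnegative : ∀ p → 0ℚ ≤ y p
      covers      : ∀ i → 1ℚ ≤ sumℚ (map y (patternsWith i))

  suppℚ : (Pattern → ℚ) → Pred Pattern 0ℓ
  suppℚ y p = y p ≢ 0ℚ

  suppℕ : (Pattern → ℕ) → Pred Pattern 0ℓ
  suppℕ x p = x p ≢ 0

fromℕ : ℕ → ℚ
fromℕ m = + m / 1

-- The inequality of real numbers  A ≥ B + c · (log₂ n)²,  for n ≥ 1 and c ≥ 0.
-- Since a / b ≤ log₂ n iff 2ᵃ ≤ nᵇ, the a / b below run over all nonnegative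
-- rationals up to log₂ n, whose supremum is log₂ n itself.
_≥_+_·log²_ : ℚ → ℚ → ℚ → ℕ → Set
A ≥ B + c ·log² n =
  ∀ (a b : ℕ) .{{_ : ℕ.NonZero b}} → 2 ^ a ℕ.≤ n ^ b →
  B + c * ((+ a / b) * (+ a / b)) ≤ A

{-# OPTIONS --safe #-}
module Submission where

-- The items form k levels; the sizes halve and the numbers of copies double from one level to
-- the next. Within a level all sizes are equal, and the items are listed in three classes, in
-- each of which the 3 ^ k symbols are arranged by one of three permutations with prefix
-- discrepancy Ω(k). A symbol is a pattern of total size 1; each item lies in the patterns of two
-- symbols adjacent in its class, so y takes every symbol 1/2 times. For an integral x put
-- z = 2 x − 1, which is odd for every symbol. Condition (ii) says that on every prefix of the items
-- the sum T of the z-values, plus twice the number E of items of D, is nonnegative. Hence a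
-- prefix on which z is very negative forces items into D, and U = T + 4 E ≥ |T| cannot be small
-- both before and after a level. As all patterns have size 1, twice the excess of x over y is the
-- sum over the levels of the item size times the increase of U; summation by parts makes every
-- level contribute Ω(k), in total Ω(k²) = Ω(log² n).

-- A single order is balanced by alternating signs; only the sum of the lowest prefixes of all three
-- orders is forced down. Since the sum S over all symbols is not controlled, the induction bounds
-- it relative to S, with a term |S| that pays when the three blocks have nearly equal sums; oddness
-- keeps |S| ≥ 1 at every depth. The pattern of a symbol has items of its own level only, so a level
-- is linked to the later ones through T and E alone. A level may lower U and so have negative cost,
-- but what it returns was paid for at no less than twice the size; a potential proportional to size
-- times U records this. Constants: pairing and the additional symbol cost 3 · 8 + 13 = 37, and one
-- level yields 3 M (2 k - 37) ≤ 61 (U₀ + U₁) with 61 = 48 + 13. In the summation by parts W U₁ has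
-- the coefficient 366 + 122 = 488, and W U₀ has 2 · 366 - 488 = 244 ≥ 122 available. For k ≥ 37 the
-- excess is at least k² / 488, and n ≤ 2 ^ (4 k) turns this into 1 / 7808 = 1 / (16 · 488).

open import Defs
open import Data.Bool.Base using (Bool; true; false; T; _∧_; _∨_; if_then_else_)
import Data.Bool.Properties as Bool
open import Data.Fin.Base as Fin using (Fin; toℕ)
open import Data.Fin.Patterns using (0F; 1F; 2F)
import Data.Fin.Properties as Fin
open import Data.Fin.Subset using (Subset; inside; outside)
open import Data.Fin.Subset.Properties using (_∈?_)
import Data.Integer.Base as ℤ
import Data.Integer.Properties as ℤ
open import Data.List.Base as List
  using (List; []; _∷_; _++_; concatMap; filter; foldr; length; replicate; allFin; tabulate)
open import Data.List.Base using (map; sum)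
open import Data.List.Membership.Propositional using (_∈_)
open import Data.List.Membership.Propositional.Properties using (∈-lookup)
import Data.List.Properties as List
open import Data.List.Relation.Unary.All as All using (All; []; _∷_)
import Data.List.Relation.Unary.All.Properties as All
open import Data.List.Relation.Unary.AllPairs using (AllPairs; []; _∷_)
import Data.List.Relation.Unary.AllPairs.Properties as AllPairs
open import Data.List.Relation.Unary.Any using (here; there)
open import Data.Maybe.Base using (Maybe; just; nothing)
import Data.Maybe.Properties as Maybe
open import Data.Nat.Base as ℕ using (ℕ; zero; suc)
import Data.Nat.ListAction as ℕ
import Data.Nat.ListAction.Properties as ℕ
import Data.Nat.Properties as ℕ
import Data.Nat.Tactic.RingSolver as ℕ
open import Data.Product using (Σ-syntax; ∃-syntax; _×_; _,_; proj₁; proj₂)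
open import Data.Refinement using (value)
open import Data.Sum.Base using (_⊎_; inj₁; inj₂)
open import Data.Vec.Base as Vec using (Vec; []; _∷_)
import Data.Vec.Properties as Vec
open import Function.Base using (_∘_; id)
open import Function.Bundles using (mk⇔)
open import Level using (0ℓ)
open import Relation.Binary.Definitions using (DecidableEquality)
open import Relation.Binary.PropositionalEquality
  using (_≡_; _≢_; refl; sym; trans; cong; cong₂; subst; subst₂; module ≡-Reasoning)
open import Relation.Nullary using (Dec; yes; no; does; ¬?; contradiction)
open import Relation.Nullary.Decidable using (dec-true; dec-false; does-⇔)
open import Relation.Unary using (Pred; Decidable; _⊆_)

-- The block orders of the three permutations of Newman, Neiman and Nikolov.
order : Fin 3 → List (Fin 3)
order 0F = 0F ∷ 1F ∷ 2F ∷ []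
order 1F = 2F ∷ 0F ∷ 1F ∷ []
order 2F = 1F ∷ 2F ∷ 0F ∷ []

perm : Fin 3 → ∀ k → List (Vec (Fin 3) k)
perm r zero    = [] ∷ []
perm r (suc k) = concatMap (λ b → map (b ∷_) (perm r k)) (order r)

-- Integer inequalities from nonnegative combinations.

module LinearArithmetic where
  open import Data.Integer.Base hiding (suc)
  open import Data.Integer.Properties

  infixl 6 _⊕_
  infixr 7 _⊗_

  gap : ∀ {i j} → i ≤ j → 0ℤ ≤ j - i
  gap = i≤j⇒0≤j-i

  _⊕_ : ∀ {i j} → 0ℤ ≤ i → 0ℤ ≤ j → 0ℤ ≤ i + j
  _⊕_ = +-mono-≤

  _⊗_ : ∀ n {i} → 0ℤ ≤ i → 0ℤ ≤ + n * i
  n ⊗ 0≤i = subst (_≤ + n * _) (*-zeroʳ (+ n)) (*-monoˡ-≤-nonNeg (+ n) 0≤i)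

  -- A linear inequality follows from a nonnegative combination of hypotheses and a ring identity.
  linear : ∀ {i j s} → 0ℤ ≤ s → s ≡ j - i → i ≤ j
  linear 0≤s refl = 0≤i-j⇒j≤i 0≤s

-- Prefix discrepancy of the three permutations.

module Discrepancy where
  open import Data.Integer.Base hiding (suc)
  open import Data.Integer.Properties
  open import Data.Integer.Tactic.RingSolver using (solve-∀)
  open LinearArithmetic

  sumℤ : List ℤ → ℤ
  sumℤ = foldr _+_ 0ℤ

  sumℤ-++ : ∀ xs ys → sumℤ (xs ++ ys) ≡ sumℤ xs + sumℤ ys
  sumℤ-++ []       ys = sym (+-identityˡ _)
  sumℤ-++ (x ∷ xs) ys = trans (cong (_+_ x) (sumℤ-++ xs ys)) (sym (+-assoc x _ _))

  minPrefix : List ℤ → ℤ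
  minPrefix []       = 0ℤ
  minPrefix (z ∷ zs) = 0ℤ ⊓ (z + minPrefix zs)

  minPrefix≤0 : ∀ zs → minPrefix zs ≤ 0ℤ
  minPrefix≤0 []       = ≤-refl
  minPrefix≤0 (z ∷ zs) = i⊓j≤i 0ℤ _

  minPrefix-++ˡ : ∀ xs ys → minPrefix (xs ++ ys) ≤ minPrefix xs
  minPrefix-++ˡ []       ys = minPrefix≤0 ys
  minPrefix-++ˡ (x ∷ xs) ys = ⊓-monoʳ-≤ 0ℤ (+-monoʳ-≤ x (minPrefix-++ˡ xs ys))

  minPrefix-++ʳ : ∀ xs ys → minPrefix (xs ++ ys) ≤ sumℤ xs + minPrefix ys
  minPrefix-++ʳ []       ys = ≤-reflexive (sym (+-identityˡ _))
  minPrefix-++ʳ (x ∷ xs) ys = begin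
    0ℤ ⊓ (x + minPrefix (xs ++ ys)) ≤⟨ i⊓j≤j 0ℤ _ ⟩
    x + minPrefix (xs ++ ys)        ≤⟨ +-monoʳ-≤ x (minPrefix-++ʳ xs ys) ⟩
    x + (sumℤ xs + minPrefix ys)    ≡⟨ +-assoc x _ _ ⟨
    sumℤ (x ∷ xs) + minPrefix ys    ∎
    where open ≤-Reasoning

  block : ∀ {A : Set} {k} → (Vec (Fin 3) (suc k) → A) → Fin 3 → Vec (Fin 3) k → A
  block v b w = v (b ∷ w)

  map-perm : ∀ {A : Set} {k} (v : Vec (Fin 3) (suc k) → A) r →
             map v (perm r (suc k)) ≡ concatMap (λ b → map (block v b) (perm r k)) (order r)
  map-perm {k = k} v r = trans (List.map-concatMap v _ (order r))
    (List.concatMap-cong (λ b → sym (List.map-∘ (perm r k))) (order r))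

  -- Recursion over the blocks in one fixed order, so that the value visibly does not depend on a
  -- permutation.
  total : ∀ k → (Vec (Fin 3) k → ℤ) → ℤ
  total zero    v = v []
  total (suc k) v = total k (block v 0F) + total k (block v 1F) + total k (block v 2F)

  sumℤ-++₃ : ∀ xs ys zs → sumℤ (xs ++ ys ++ zs ++ []) ≡ sumℤ xs + (sumℤ ys + sumℤ zs)
  sumℤ-++₃ xs ys zs = begin
    sumℤ (xs ++ ys ++ zs ++ [])          ≡⟨ sumℤ-++ xs _ ⟩
    sumℤ xs + sumℤ (ys ++ zs ++ [])      ≡⟨ cong (_+_ (sumℤ xs)) (sumℤ-++ ys _) ⟩
    sumℤ xs + (sumℤ ys + sumℤ (zs ++ [])) ≡⟨ cong (λ l → sumℤ xs + (sumℤ ys + sumℤ l)) (List.++-identityʳ zs) ⟩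
    sumℤ xs + (sumℤ ys + sumℤ zs)        ∎
    where open ≡-Reasoning

  sumℤ-perm : ∀ r k v → sumℤ (map v (perm r k)) ≡ total k v
  sumℤ-perm r zero    v = +-identityʳ _
  sumℤ-perm r (suc k) v = begin
    sumℤ (map v (perm r (suc k)))                                    ≡⟨ cong sumℤ (map-perm v r) ⟩
    sumℤ (concatMap (λ b → map (block v b) (perm r k)) (order r))    ≡⟨ rearrange r ⟩
    total (suc k) v                                                  ∎
    where
    open ≡-Reasoning
    blocks : ∀ b₁ b₂ b₃ →
             sumℤ (concatMap (λ b → map (block v b) (perm r k)) (b₁ ∷ b₂ ∷ b₃ ∷ [])) ≡
             total k (block v b₁) + (total k (block v b₂) + total k (block v b₃))
    blocks b₁ b₂ b₃ = trans (sumℤ-++₃ (map (block v b₁) (perm r k)) (map (block v b₂) (perm r k)) _)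
      (cong₂ _+_ (sumℤ-perm r k _) (cong₂ _+_ (sumℤ-perm r k _) (sumℤ-perm r k _)))
    231→123 : ∀ a b c → c + (a + b) ≡ a + b + c
    231→123 = solve-∀
    312→123 : ∀ a b c → b + (c + a) ≡ a + b + c
    312→123 = solve-∀
    rearrange : ∀ r′ → sumℤ (concatMap (λ b → map (block v b) (perm r k)) (order r′)) ≡ total (suc k) v
    rearrange 0F = trans (blocks 0F 1F 2F) (sym (+-assoc (total k (block v 0F)) _ _))
    rearrange 1F = trans (blocks 2F 0F 1F) (231→123 (total k (block v 0F)) _ _)
    rearrange 2F = trans (blocks 1F 2F 0F) (312→123 (total k (block v 0F)) _ _)

  lowest : Fin 3 → ∀ k → (Vec (Fin 3) k → ℤ) → ℤ
  lowest r k v = minPrefix (map v (perm r k))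

  lowestSum : ∀ k → (Vec (Fin 3) k → ℤ) → ℤ
  lowestSum k v = lowest 0F k v + lowest 1F k v + lowest 2F k v

  module _ k (v : Vec (Fin 3) (suc k) → ℤ) r b₁ b₂ b₃ (order≡ : order r ≡ b₁ ∷ b₂ ∷ b₃ ∷ []) where
    private
      xs : Fin 3 → List ℤ
      xs b = map (block v b) (perm r k)

      unfold : lowest r (suc k) v ≡ minPrefix (xs b₁ ++ xs b₂ ++ xs b₃ ++ [])
      unfold = cong minPrefix (trans (map-perm v r) (cong (concatMap xs) order≡))

    -- Prefixes that end inside a given block are prefixes of that block, shifted by the sums of the
    -- blocks before it. The three versions are for the block in first, second and third place.
    lowest-block₁ : lowest r (suc k) v ≤ lowest r k (block v b₁)
    lowest-block₁ = ≤-trans (≤-reflexive unfold) (minPrefix-++ˡ (xs b₁) _)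

    lowest-block₂ : lowest r (suc k) v ≤ total k (block v b₁) + lowest r k (block v b₂)
    lowest-block₂ = begin
      lowest r (suc k) v                                    ≡⟨ unfold ⟩
      minPrefix (xs b₁ ++ xs b₂ ++ xs b₃ ++ [])             ≤⟨ minPrefix-++ʳ (xs b₁) _ ⟩
      sumℤ (xs b₁) + minPrefix (xs b₂ ++ xs b₃ ++ [])       ≤⟨ +-monoʳ-≤ (sumℤ (xs b₁)) (minPrefix-++ˡ (xs b₂) _) ⟩
      sumℤ (xs b₁) + minPrefix (xs b₂)                      ≡⟨ cong (_+ _) (sumℤ-perm r k _) ⟩
      total k (block v b₁) + lowest r k (block v b₂)        ∎
      where open ≤-Reasoning

    lowest-block₃ : lowest r (suc k) v ≤
                    total k (block v b₁) + (total k (block v b₂) + lowest r k (block v b₃))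
    lowest-block₃ = begin
      lowest r (suc k) v                                           ≡⟨ unfold ⟩
      minPrefix (xs b₁ ++ xs b₂ ++ xs b₃ ++ [])                    ≤⟨ minPrefix-++ʳ (xs b₁) _ ⟩
      sumℤ (xs b₁) + minPrefix (xs b₂ ++ xs b₃ ++ [])
        ≤⟨ +-monoʳ-≤ (sumℤ (xs b₁)) (minPrefix-++ʳ (xs b₂) _) ⟩
      sumℤ (xs b₁) + (sumℤ (xs b₂) + minPrefix (xs b₃ ++ []))
        ≤⟨ +-monoʳ-≤ (sumℤ (xs b₁)) (+-monoʳ-≤ (sumℤ (xs b₂)) (minPrefix-++ˡ (xs b₃) [])) ⟩
      sumℤ (xs b₁) + (sumℤ (xs b₂) + minPrefix (xs b₃))
        ≡⟨ cong₂ _+_ (sumℤ-perm r k _) (cong (_+ _) (sumℤ-perm r k _)) ⟩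
      total k (block v b₁) + (total k (block v b₂) + lowest r k (block v b₃)) ∎
      where open ≤-Reasoning

  Odd : ℤ → Set
  Odd z = ∃[ w ] z ≡ 1ℤ + + 2 * w

  odd-sign : ∀ {z} → Odd z → (1ℤ ≤ z) ⊎ (z ≤ -1ℤ)
  odd-sign (+ n , refl) = inj₁ (linear (2 ⊗ +≤+ (ℕ.z≤n {n})) (identity (+ n)))
    where
    identity : ∀ n → + 2 * n ≡ 1ℤ + + 2 * n - 1ℤ
    identity = solve-∀
  odd-sign (-[1+ n ] , refl) = inj₂ (linear (2 ⊗ +≤+ (ℕ.z≤n {n})) (identity (+ n)))
    where
    identity : ∀ n → + 2 * n ≡ -1ℤ - (1ℤ + + 2 * (- (1ℤ + n)))
    identity = solve-∀

  total-odd : ∀ k {v} → (∀ w → Odd (v w)) → Odd (total k v)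
  total-odd zero    odd = odd []
  total-odd (suc k) odd
    with x , eqx ← total-odd k (λ w → odd (0F ∷ w))
       | y , eqy ← total-odd k (λ w → odd (1F ∷ w))
       | z , eqz ← total-odd k (λ w → odd (2F ∷ w))
    = 1ℤ + x + y + z , trans (cong₂ _+_ (cong₂ _+_ eqx eqy) eqz) (identity x y z)
    where
    identity : ∀ x y z → 1ℤ + + 2 * x + (1ℤ + + 2 * y) + (1ℤ + + 2 * z) ≡ 1ℤ + + 2 * (1ℤ + x + y + z)
    identity = solve-∀

  -- 8 P + 2 k ≤ 12 S + |S|
  data Low (k P S : ℤ) : Set where
    low⁺ : + 8 * P + + 2 * k ≤ + 13 * S → Low k P S
    low⁻ : + 8 * P + + 2 * k ≤ + 11 * S → Low k P S

  low-elim : ∀ {k P S} {X : Set} → (+ 8 * P + + 2 * k ≤ + 13 * S → X) → (+ 8 * P + + 2 * k ≤ + 11 * S → X) →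
             Low k P S → X
  low-elim f g (low⁺ h) = f h
  low-elim f g (low⁻ h) = g h

  -- For a positive sum 11 S ≤ 13 S, so both alternatives of `Low` merge into the weaker one;
  -- `low-negative` is the mirror image.
  low-positive : ∀ {k P S} → 1ℤ ≤ S → Low k P S → + 8 * P + + 2 * k ≤ + 13 * S
  low-positive 1≤S (low⁺ h) = h
  low-positive {k} {P} {S} 1≤S (low⁻ h) = linear (gap h ⊕ 2 ⊗ gap 1≤S ⊕ 2 ⊗ (+≤+ (ℕ.z≤n {1}))) (identity k P S)
    where
    identity : ∀ k P S → + 11 * S - (+ 8 * P + + 2 * k) + + 2 * (S - 1ℤ) + + 2 * 1ℤ ≡ + 13 * S - (+ 8 * P + + 2 * k)
    identity = solve-∀

  low-negative : ∀ {k P S} → S ≤ -1ℤ → Low k P S → + 8 * P + + 2 * k ≤ + 11 * S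
  low-negative S≤-1 (low⁻ h) = h
  low-negative {k} {P} {S} S≤-1 (low⁺ h) = linear (gap h ⊕ 2 ⊗ gap S≤-1 ⊕ 2 ⊗ (+≤+ (ℕ.z≤n {1}))) (identity k P S)
    where
    identity : ∀ k P S → + 13 * S - (+ 8 * P + + 2 * k) + + 2 * (-1ℤ - S) + + 2 * 1ℤ ≡ + 11 * S - (+ 8 * P + + 2 * k)
    identity = solve-∀

  -- Since 8 (b + 2 c) = 12 (b + c) - 4 (b - c), entering the block with sum a gains 4 (b - c) + |a
  -- + b + c| - |a|, which has to reach 2. With u = b - c the largest of the cyclic differences, the
  -- surplus is u + 2 (u - (a - b)) + 2 (a - 1) for a ≥ 1, and u + 2 (u - (c - a)) + 2 (-1 - a) for
  -- a ≤ -1. For a = b = c = 0 there would be no gain at all, hence the parity.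
  low-step : ∀ {k P Pa} a b c → Odd a → Low k Pa a → P ≤ Pa + b + + 2 * c →
             0ℤ ≤ b - c → c - a ≤ b - c → a - b ≤ b - c → Low (1ℤ + k) P (a + b + c)
  low-step {k} {P} {Pa} a b c odd-a low P≤ 0≤u v≤u w≤u with odd-sign odd-a
  ... | inj₁ 1≤a = low⁺ (linear
    (gap (low-positive 1≤a low) ⊕ 8 ⊗ gap P≤ ⊕ 0≤u ⊕ 2 ⊗ gap w≤u ⊕ 2 ⊗ gap 1≤a) (identity k P Pa a b c))
    where
    identity : ∀ k P Pa a b c →
      + 13 * a - (+ 8 * Pa + + 2 * k) + + 8 * (Pa + b + + 2 * c - P) + (b - c)
        + + 2 * (b - c - (a - b)) + + 2 * (a - 1ℤ)
      ≡ + 13 * (a + b + c) - (+ 8 * P + + 2 * (1ℤ + k))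
    identity = solve-∀
  ... | inj₂ a≤-1 = low⁻ (linear
    (gap (low-negative a≤-1 low) ⊕ 8 ⊗ gap P≤ ⊕ 0≤u ⊕ 2 ⊗ gap v≤u ⊕ 2 ⊗ gap a≤-1) (identity k P Pa a b c))
    where
    identity : ∀ k P Pa a b c →
      + 11 * a - (+ 8 * Pa + + 2 * k) + + 8 * (Pa + b + + 2 * c - P) + (b - c)
        + + 2 * (b - c - (c - a)) + + 2 * (-1ℤ - a)
      ≡ + 11 * (a + b + c) - (+ 8 * P + + 2 * (1ℤ + k))
    identity = solve-∀

  -- The three cyclic differences add up to zero, so the largest of them cannot be negative.
  max-nonnegative : ∀ a b c → c - a ≤ b - c → a - b ≤ b - c → 0ℤ ≤ b - c
  max-nonnegative a b c v≤u w≤u =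
    *-cancelˡ-≤-pos 0ℤ (b - c) (+ 3) (linear (gap v≤u ⊕ gap w≤u) (identity a b c))
    where
    identity : ∀ a b c → b - c - (c - a) + (b - c - (a - b)) ≡ + 3 * (b - c) - + 3 * 0ℤ
    identity = solve-∀

  -- By rotation, b − c may be taken to be the largest of b − c, c − a and a − b.
  low-rotate : ∀ {k P S} (a b c : ℤ) {Pa Pb Pc} → Odd a → Odd b → Odd c →
           Low k Pa a → Low k Pb b → Low k Pc c →
           P ≤ Pa + b + + 2 * c → P ≤ Pb + c + + 2 * a → P ≤ Pc + a + + 2 * b →
           S ≡ a + b + c → Low (1ℤ + k) P S
  low-rotate {k} {P} a b c {Pa} {Pb} {Pc} oa ob oc la lb lc P≤a P≤b P≤c refl
    with ≤-total (b - c) (c - a) | ≤-total (c - a) (a - b) | ≤-total (a - b) (b - c)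
  ... | inj₂ v≤u | _ | inj₁ w≤u = low-step {Pa = Pa} a b c oa la P≤a (max-nonnegative a b c v≤u w≤u) v≤u w≤u
  ... | inj₁ u≤v | inj₂ w≤v | _ = subst (Low (1ℤ + k) P) (bca a b c)
    (low-step {Pa = Pb} b c a ob lb P≤b (max-nonnegative b c a w≤v u≤v) w≤v u≤v)
    where
    bca : ∀ a b c → b + c + a ≡ a + b + c
    bca = solve-∀
  ... | _ | inj₁ v≤w | inj₂ u≤w = subst (Low (1ℤ + k) P) (cab a b c)
    (low-step {Pa = Pc} c a b oc lc P≤c (max-nonnegative c a b u≤w v≤w) u≤w v≤w)
    where
    cab : ∀ a b c → c + a + b ≡ a + b + c
    cab = solve-∀
  -- In the two remaining cases the comparisons run in a cycle, so all three differences are equal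
  -- and any block will do.
  ... | inj₁ u≤v | inj₁ v≤w | inj₁ w≤u =
    low-step {Pa = Pa} a b c oa la P≤a (max-nonnegative a b c v≤u w≤u) v≤u w≤u
    where v≤u = ≤-trans v≤w w≤u
  ... | inj₂ v≤u | inj₂ w≤v | inj₂ u≤w =
    low-step {Pa = Pa} a b c oa la P≤a (max-nonnegative a b c v≤u w≤u) v≤u w≤u
    where w≤u = ≤-trans w≤v v≤u

  -- Every block stands first, second and third in one order each. The blocks before block `0F` sum
  -- to 0, c and b + c, in all b + 2 c; the other two blocks give the cyclic shifts of this, and
  -- `low-rotate` chooses among the three.
  lowestSum-low : ∀ k v → (∀ w → Odd (v w)) → Low (+ k) (lowestSum k v) (total k v)
  lowestSum-low zero v odd
    with odd-sign (odd []) | subst (λ z → 0ℤ ⊓ z ≤ v []) (sym (+-identityʳ (v []))) (i⊓j≤j 0ℤ (v []))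
  ... | inj₁ 1≤z | _ = low⁺ (linear
    (24 ⊗ gap (minPrefix≤0 (v [] ∷ [])) ⊕ 13 ⊗ gap 1≤z ⊕ 13 ⊗ (+≤+ (ℕ.z≤n {1})))
    (identity (minPrefix (v [] ∷ [])) (v [])))
    where
    identity : ∀ P S → + 24 * (0ℤ - P) + + 13 * (S - 1ℤ) + + 13 * 1ℤ ≡ + 13 * S - (+ 8 * (P + P + P) + + 2 * 0ℤ)
    identity = solve-∀
  ... | inj₂ z≤-1 | P≤S = low⁻ (linear
    (24 ⊗ gap P≤S ⊕ 13 ⊗ gap z≤-1 ⊕ 13 ⊗ (+≤+ (ℕ.z≤n {1})))
    (identity (minPrefix (v [] ∷ [])) (v [])))
    where
    identity : ∀ P S → + 24 * (S - P) + + 13 * (-1ℤ - S) + + 13 * 1ℤ ≡ + 11 * S - (+ 8 * (P + P + P) + + 2 * 0ℤ)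
    identity = solve-∀
  lowestSum-low (suc k) v odd =
    low-rotate a b c (odd′ 0F) (odd′ 1F) (odd′ 2F) (low 0F) (low 1F) (low 2F)
      (linear (gap (lowest-block₁ k v 0F 0F 1F 2F refl)
        ⊕ gap (lowest-block₂ k v 1F 2F 0F 1F refl) ⊕ gap (lowest-block₃ k v 2F 1F 2F 0F refl))
        (identityᵃ (l 0F 0F) (l 0F 1F) (l 0F 2F) (P 0F) (P 1F) (P 2F) b c))
      (linear (gap (lowest-block₂ k v 0F 0F 1F 2F refl)
        ⊕ gap (lowest-block₃ k v 1F 2F 0F 1F refl) ⊕ gap (lowest-block₁ k v 2F 1F 2F 0F refl))
        (identityᵇ (l 1F 0F) (l 1F 1F) (l 1F 2F) (P 0F) (P 1F) (P 2F) a c))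
      (linear (gap (lowest-block₃ k v 0F 0F 1F 2F refl)
        ⊕ gap (lowest-block₁ k v 1F 2F 0F 1F refl) ⊕ gap (lowest-block₂ k v 2F 1F 2F 0F refl))
        (identityᶜ (l 2F 0F) (l 2F 1F) (l 2F 2F) (P 0F) (P 1F) (P 2F) a b))
      refl
    where
    a = total k (block v 0F)
    b = total k (block v 1F)
    c = total k (block v 2F)
    l : Fin 3 → Fin 3 → ℤ
    l b r = lowest r k (block v b)
    P : Fin 3 → ℤ
    P r = lowest r (suc k) v
    odd′ : ∀ i → Odd (total k (block v i))
    odd′ i = total-odd k (λ w → odd (i ∷ w))
    low : ∀ i → Low (+ k) (lowestSum k (block v i)) (total k (block v i))
    low i = lowestSum-low k (block v i) (λ w → odd (i ∷ w))
    identityᵃ : ∀ l₀ l₁ l₂ P₀ P₁ P₂ b c →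
      l₀ - P₀ + (c + l₁ - P₁) + (b + (c + l₂) - P₂) ≡ l₀ + l₁ + l₂ + b + + 2 * c - (P₀ + P₁ + P₂)
    identityᵃ = solve-∀
    identityᵇ : ∀ l₀ l₁ l₂ P₀ P₁ P₂ a c →
      a + l₀ - P₀ + (c + (a + l₁) - P₁) + (l₂ - P₂) ≡ l₀ + l₁ + l₂ + c + + 2 * a - (P₀ + P₁ + P₂)
    identityᵇ = solve-∀
    identityᶜ : ∀ l₀ l₁ l₂ P₀ P₁ P₂ a b →
      a + (b + l₀) - P₀ + (l₁ - P₁) + (b + l₂ - P₂) ≡ l₀ + l₁ + l₂ + a + + 2 * b - (P₀ + P₁ + P₂)
    identityᶜ = solve-∀

-- The items: pairs of symbols adjacent in an order.

data OddLength {A : Set} : List A → Set where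
  one  : ∀ {x} → OddLength (x ∷ [])
  _+2  : ∀ {x y xs} → OddLength xs → OddLength (x ∷ y ∷ xs)

oddLength-map : ∀ {A B : Set} (f : A → B) {xs} → OddLength xs → OddLength (map f xs)
oddLength-map f one    = one
oddLength-map f (o +2) = oddLength-map f o +2

oddLength-∷-++ : ∀ {A : Set} {x : A} {ys zs} → OddLength ys → OddLength zs → OddLength (x ∷ ys ++ zs)
oddLength-∷-++ one    oz = oz +2
oddLength-∷-++ (o +2) oz = oddLength-∷-++ o oz +2

oddLength-++₃ : ∀ {A : Set} {xs ys zs : List A} →
                OddLength xs → OddLength ys → OddLength zs → OddLength (xs ++ ys ++ zs)
oddLength-++₃ one     oy oz = oddLength-∷-++ oy oz
oddLength-++₃ (ox +2) oy oz = oddLength-++₃ ox oy oz +2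

oddLength-perm : ∀ r k → OddLength (perm r k)
oddLength-perm r zero    = one
oddLength-perm r (suc k) = go r
  where
  part : ∀ b → OddLength (map (b ∷_) (perm r k))
  part b = oddLength-map (b ∷_) (oddLength-perm r k)
  three : ∀ b₁ b₂ b₃ → OddLength (concatMap (λ b → map (b ∷_) (perm r k)) (b₁ ∷ b₂ ∷ b₃ ∷ []))
  three b₁ b₂ b₃ = oddLength-++₃ (part b₁) (part b₂)
    (subst OddLength (sym (List.++-identityʳ (map (b₃ ∷_) (perm r k)))) (part b₃))
  go : ∀ r′ → OddLength (concatMap (λ b → map (b ∷_) (perm r k)) (order r′))
  go 0F = three 0F 1F 2F
  go 1F = three 2F 0F 1F
  go 2F = three 1F 2F 0F

-- On lists of odd length, where it is used, the last entry is left over and `e` becomes its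
-- partner. The recursion by two entries is that of `OddLength`.
pairUp : ∀ {A : Set} → List A → A → List (A × A)
pairUp []           e = []
pairUp (x ∷ [])     e = (x , e) ∷ []
pairUp (x ∷ y ∷ xs) e = (x , y) ∷ pairUp xs e

Symbol : ℕ → Set
Symbol k = Maybe (Vec (Fin 3) k)

-- The additional symbol makes the number of symbols even.
classPairs : Fin 3 → ∀ k → List (Symbol k × Symbol k)
classPairs c k = pairUp (map just (perm c k)) nothing

Item : ℕ → Set
Item k = ℕ × Symbol k × Symbol k

module _ (k : ℕ) where
  classItems : Fin 3 → ℕ → ℕ → List (Item k)
  classItems c r M = concatMap (λ p → replicate M (r , p)) (classPairs c k)

  levelItems : ℕ → ℕ → List (Item k)
  levelItems r M = classItems 0F r M ++ classItems 1F r M ++ classItems 2F r M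

  -- r counts the levels that follow, so the item sizes of a level are proportional to 2 ^ r.
  items : ℕ → ℕ → List (Item k)
  items zero    M = []
  items (suc r) M = levelItems r M ++ items r (2 ℕ.* M)

-- Cuts a labelled list of items at the boundaries of its underlying item list, so that levels,
-- classes and pairs can be split off with their labels.
map-++⁻ : ∀ {A B : Set} (f : A → B) l {xs ys} → map f l ≡ xs ++ ys →
          ∃[ l₁ ] ∃[ l₂ ] l ≡ l₁ ++ l₂ × map f l₁ ≡ xs × map f l₂ ≡ ys
map-++⁻ f l {[]}         eq = [] , l , refl , refl , eq
map-++⁻ f (a ∷ l) {x ∷ xs} eq
  with l₁ , l₂ , refl , eq₁ , eq₂ ← map-++⁻ f l (List.∷-injectiveʳ eq)
  = a ∷ l₁ , l₂ , refl , cong₂ _∷_ (List.∷-injectiveˡ eq) eq₁ , eq₂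

-- Lowest prefixes after pairing.

module Levels where
  open import Data.Integer.Base hiding (suc)
  open import Data.Integer.Properties
  open import Data.Integer.Tactic.RingSolver using (solve-∀)
  open LinearArithmetic
  open Discrepancy

  ⊓-elim : (P : ℤ → Set) → ∀ i j → P i → P j → P (i ⊓ j)
  ⊓-elim P i j Pi Pj with ⊓-sel i j
  ... | inj₁ eq = subst P (sym eq) Pi
  ... | inj₂ eq = subst P (sym eq) Pj

  minPrefix-one : ∀ x → -1ℤ ≤ x → ∀ p → p ≤ 0ℤ → p ≤ 0ℤ ⊓ (x + 0ℤ) + 1ℤ
  minPrefix-one x x≥-1 p p≤0 = ⊓-elim (λ t → p ≤ t + 1ℤ) 0ℤ (x + 0ℤ)
    (≤-trans p≤0 (+≤+ ℕ.z≤n)) (linear (gap p≤0 ⊕ gap x≥-1) (identity p x))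
    where
    identity : ∀ p x → 0ℤ - p + (x - -1ℤ) ≡ x + 0ℤ + 1ℤ - p
    identity = solve-∀

  minPrefix-two : ∀ x → -1ℤ ≤ x → ∀ y m m′ → m′ ≤ m + 1ℤ → 0ℤ ⊓ (x + y + m′) ≤ 0ℤ ⊓ (x + (0ℤ ⊓ (y + m))) + 1ℤ
  minPrefix-two x x≥-1 y m m′ m′≤m+1 = ⊓-elim (λ t → p ≤ t + 1ℤ) 0ℤ (x + (0ℤ ⊓ (y + m)))
    (≤-trans p≤0 (+≤+ ℕ.z≤n))
    (⊓-elim (λ t → p ≤ x + t + 1ℤ) 0ℤ (y + m)
      (linear (gap p≤0 ⊕ gap x≥-1) (identity₁ p x))
      (linear (gap p≤s ⊕ gap m′≤m+1) (identity₂ p x y m m′)))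
    where
    p = 0ℤ ⊓ (x + y + m′)
    p≤0 : p ≤ 0ℤ
    p≤0 = i⊓j≤i 0ℤ _
    p≤s : p ≤ x + y + m′
    p≤s = i⊓j≤j 0ℤ _
    identity₁ : ∀ p x → 0ℤ - p + (x - -1ℤ) ≡ x + 0ℤ + 1ℤ - p
    identity₁ = solve-∀
    identity₂ : ∀ p x y m m′ → x + y + m′ - p + (m + 1ℤ - m′) ≡ x + (y + m) + 1ℤ - p
    identity₂ = solve-∀

  -- The constant 37 is 3 · 8 for a loss of 1 in each of the three minima, plus 13 for the
  -- additional symbol: e ≥ -1 gives S ≤ m + 1.
  lowestPair-low⁺ : ∀ p₀ p₁ p₂ l₀ l₁ l₂ k S e m → p₀ ≤ l₀ + 1ℤ → p₁ ≤ l₁ + 1ℤ → p₂ ≤ l₂ + 1ℤ →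
           -1ℤ ≤ e → S + e ≤ m → + 8 * (l₀ + l₁ + l₂) + + 2 * k ≤ + 13 * S →
           + 8 * (p₀ + p₁ + p₂) + + 2 * k ≤ + 13 * m + + 37
  lowestPair-low⁺ p₀ p₁ p₂ l₀ l₁ l₂ k S e m h₀ h₁ h₂ e≥-1 S+e≤m h =
    linear (8 ⊗ (gap h₀ ⊕ gap h₁ ⊕ gap h₂) ⊕ gap h ⊕ 13 ⊗ gap e≥-1 ⊕ 13 ⊗ gap S+e≤m)
      (identity p₀ p₁ p₂ l₀ l₁ l₂ k S e m)
    where
    identity : ∀ p₀ p₁ p₂ l₀ l₁ l₂ k S e m →
      + 8 * (l₀ + 1ℤ - p₀ + (l₁ + 1ℤ - p₁) + (l₂ + 1ℤ - p₂)) + (+ 13 * S - (+ 8 * (l₀ + l₁ + l₂) + + 2 * k))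
        + + 13 * (e - -1ℤ) + + 13 * (m - (S + e))
      ≡ + 13 * m + + 37 - (+ 8 * (p₀ + p₁ + p₂) + + 2 * k)
    identity = solve-∀

  -- As 11 (m + 1) ≤ 13 (m + 1) for m ≥ 0, the negative alternative ends in the same bound, and the
  -- sign of the sum is no longer distinguished afterwards.
  lowestPair-low⁻ : ∀ p₀ p₁ p₂ l₀ l₁ l₂ k S e m → p₀ ≤ l₀ + 1ℤ → p₁ ≤ l₁ + 1ℤ → p₂ ≤ l₂ + 1ℤ →
           -1ℤ ≤ e → S + e ≤ m → 0ℤ ≤ m → + 8 * (l₀ + l₁ + l₂) + + 2 * k ≤ + 11 * S →
           + 8 * (p₀ + p₁ + p₂) + + 2 * k ≤ + 13 * m + + 37
  lowestPair-low⁻ p₀ p₁ p₂ l₀ l₁ l₂ k S e m h₀ h₁ h₂ e≥-1 S+e≤m 0≤m h =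
    linear (8 ⊗ (gap h₀ ⊕ gap h₁ ⊕ gap h₂) ⊕ gap h ⊕ 11 ⊗ gap e≥-1 ⊕ 11 ⊗ gap S+e≤m
             ⊕ 2 ⊗ gap 0≤m ⊕ 2 ⊗ (+≤+ (ℕ.z≤n {1})))
      (identity p₀ p₁ p₂ l₀ l₁ l₂ k S e m)
    where
    identity : ∀ p₀ p₁ p₂ l₀ l₁ l₂ k S e m →
      + 8 * (l₀ + 1ℤ - p₀ + (l₁ + 1ℤ - p₁) + (l₂ + 1ℤ - p₂)) + (+ 11 * S - (+ 8 * (l₀ + l₁ + l₂) + + 2 * k))
        + + 11 * (e - -1ℤ) + + 11 * (m - (S + e)) + + 2 * (m - 0ℤ) + + 2 * 1ℤ
      ≡ + 13 * m + + 37 - (+ 8 * (p₀ + p₁ + p₂) + + 2 * k)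
    identity = solve-∀

  pairSum : ∀ {A : Set} → (A → ℤ) → A × A → ℤ
  pairSum f (a , b) = f a + f b

  module _ {A : Set} (f : A → ℤ) where

    sumℤ-pairUp : ∀ {xs} e → OddLength xs →
                  sumℤ (map (pairSum f) (pairUp xs e)) ≡ sumℤ (map f xs) + f e
    sumℤ-pairUp e (one {x}) = identity (f x) (f e)
      where
      identity : ∀ x e → x + e + 0ℤ ≡ x + 0ℤ + e
      identity = solve-∀
    sumℤ-pairUp e (_+2 {x} {y} {xs} o) = trans (cong (_+_ (f x + f y)) (sumℤ-pairUp e o))
      (identity (f x) (f y) (sumℤ (map f xs)) (f e))
      where
      identity : ∀ x y s e → x + y + (s + e) ≡ x + (y + s) + e
      identity = solve-∀

    -- The lowest prefix may end between the two entries of a pair. Leaving out the first entry of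
    -- that pair raises the sum by at most 1, because every value is at least -1.
    minPrefix-pairUp : (∀ a → -1ℤ ≤ f a) → ∀ {xs} e → OddLength xs →
                       minPrefix (map (pairSum f) (pairUp xs e)) ≤ minPrefix (map f xs) + 1ℤ
    minPrefix-pairUp f≥-1 e (one {x}) = minPrefix-one (f x) (f≥-1 x) _ (minPrefix≤0 (f x + f e ∷ []))
    minPrefix-pairUp f≥-1 e (_+2 {x} {y} {xs} o) =
      minPrefix-two (f x) (f≥-1 x) (f y) (minPrefix (map f xs)) (minPrefix (map (pairSum f) (pairUp xs e)))
        (minPrefix-pairUp f≥-1 e o)

  module _ {k : ℕ} (z : Symbol k → ℤ) where

    symbolTotal : ℤ
    symbolTotal = total k (z ∘ just) + z nothing

    lowestPair : Fin 3 → ℤ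
    lowestPair c = minPrefix (map (pairSum z) (classPairs c k))

    sumℤ-classPairs : ∀ c → sumℤ (map (pairSum z) (classPairs c k)) ≡ symbolTotal
    sumℤ-classPairs c = trans (sumℤ-pairUp z nothing (oddLength-map just (oddLength-perm c k)))
      (cong (_+ z nothing) (trans (cong sumℤ (sym (List.map-∘ (perm c k)))) (sumℤ-perm c k (z ∘ just))))

    lowestPair≤ : (∀ s → -1ℤ ≤ z s) → ∀ c → lowestPair c ≤ lowest c k (z ∘ just) + 1ℤ
    lowestPair≤ z≥-1 c = subst (λ v → lowestPair c ≤ minPrefix v + 1ℤ) (sym (List.map-∘ (perm c k)))
      (minPrefix-pairUp z z≥-1 nothing (oddLength-map just (oddLength-perm c k)))

    lowestPair-low : (∀ s → Odd (z s)) → (∀ s → -1ℤ ≤ z s) →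
      + 8 * (lowestPair 0F + lowestPair 1F + lowestPair 2F) + + 2 * + k ≤ + 13 * (0ℤ ⊔ symbolTotal) + + 37
    lowestPair-low odd z≥-1 = low-elim
      (lowestPair-low⁺ p₀ p₁ p₂ l₀ l₁ l₂ (+ k) S e m h₀ h₁ h₂ (z≥-1 nothing) (i≤j⊔i 0ℤ symbolTotal))
      (lowestPair-low⁻ p₀ p₁ p₂ l₀ l₁ l₂ (+ k) S e m h₀ h₁ h₂ (z≥-1 nothing) (i≤j⊔i 0ℤ symbolTotal) (i≤i⊔j 0ℤ symbolTotal))
      (lowestSum-low k (z ∘ just) (odd ∘ just))
      where
      p₀ = lowestPair 0F
      p₁ = lowestPair 1F
      p₂ = lowestPair 2F
      l₀ = lowest 0F k (z ∘ just)
      l₁ = lowest 1F k (z ∘ just)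
      l₂ = lowest 2F k (z ∘ just)
      h₀ = lowestPair≤ z≥-1 0F
      h₁ = lowestPair≤ z≥-1 1F
      h₂ = lowestPair≤ z≥-1 2F
      S = total k (z ∘ just)
      e = z nothing
      m = 0ℤ ⊔ symbolTotal

module _ {k : ℕ} where
  classItems-level : ∀ c r M → All (λ it → proj₁ it ≡ r) (classItems k c r M)
  classItems-level c r M = go (classPairs c k)
    where
    go : ∀ ps → All (λ it → proj₁ it ≡ r) (concatMap (λ p → replicate M (r , p)) ps)
    go []       = []
    go (p ∷ ps) = All.++⁺ (All.replicate⁺ M refl) (go ps)

  levelItems-level : ∀ r M → All (λ it → proj₁ it ≡ r) (levelItems k r M)
  levelItems-level r M = All.++⁺ (classItems-level 0F r M)
    (All.++⁺ (classItems-level 1F r M) (classItems-level 2F r M))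

-- Arithmetic of one level and of the summation by parts.

module Costs where
  open import Data.Integer.Base hiding (suc)
  open import Data.Integer.Properties
  open import Data.Integer.Tactic.RingSolver using (solve-∀)
  open LinearArithmetic
  open Discrepancy
  open Levels

  ⊔-elim : (P : ℤ → Set) → ∀ i j → P i → P j → P (i ⊔ j)
  ⊔-elim P i j Pi Pj with ⊔-sel i j
  ... | inj₁ eq = subst P (sym eq) Pi
  ... | inj₂ eq = subst P (sym eq) Pj

  -- Adding the three class bounds and completing the labels to 6 (e₀ + e₁ + e₂) gives 0 ≤ 2 T₀ + T₁
  -- + 6 E₁ + M (p₀ + p₁ + p₂). Times 24, and with 192 E₀ and 24 (T₁ + 2 E₁) added, the part without
  -- p₀, p₁, p₂ becomes 48 (U₀ + U₁), where U = T + 4 E. Another 13 (U₀ + U₁) pays for the term with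
  -- 0 ⊔ S in the discrepancy bound.
  level-arithmetic : ∀ M k S p₀ p₁ p₂ e₀ e₁ e₂ T₀ E₀ →
    let s = T₀ + + 2 * E₀
        T₁ = T₀ + + 3 * (+ M * S)
        E₁ = E₀ + (e₀ + (e₁ + e₂)) in
    0ℤ ≤ E₀ → 0ℤ ≤ e₀ → 0ℤ ≤ e₁ → 0ℤ ≤ e₂ → 0ℤ ≤ s → 0ℤ ≤ T₁ + + 2 * E₁ →
    0ℤ ≤ s + + M * p₀ + + 2 * e₀ →
    0ℤ ≤ s + (+ M * S + + 2 * e₀) + + M * p₁ + + 2 * e₁ →
    0ℤ ≤ s + (+ M * S + + 2 * e₀) + (+ M * S + + 2 * e₁) + + M * p₂ + + 2 * e₂ →
    + 8 * (p₀ + p₁ + p₂) + + 2 * k ≤ + 13 * (0ℤ ⊔ S) + + 37 →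
    + 3 * (+ M * (+ 2 * k - + 37)) ≤ + 61 * (T₀ + + 4 * E₀ + (T₁ + + 4 * E₁))
  level-arithmetic M k S p₀ p₁ p₂ e₀ e₁ e₂ T₀ E₀ E₀≥0 e₀≥0 e₁≥0 e₂≥0 s≥0 s₁≥0 c₀ c₁ c₂ low =
    linear
      (3 ⊗ (8 ⊗ (c₀ ⊕ c₁ ⊕ c₂ ⊕ 2 ⊗ e₁≥0 ⊕ 4 ⊗ e₂≥0) ⊕ M ⊗ gap low) ⊕ 13 ⊗ gap total≤
        ⊕ 192 ⊗ E₀≥0 ⊕ 24 ⊗ s₁≥0)
      (identity (+ M) k S p₀ p₁ p₂ e₀ e₁ e₂ T₀ E₀ (0ℤ ⊔ S))
    where
    T₁ = T₀ + + 3 * (+ M * S)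
    E₁ = E₀ + (e₀ + (e₁ + e₂))
    E₁≥0 : 0ℤ ≤ E₁
    E₁≥0 = E₀≥0 ⊕ (e₀≥0 ⊕ (e₁≥0 ⊕ e₂≥0))
    total≤ : + 3 * (+ M * (0ℤ ⊔ S)) ≤ T₀ + + 4 * E₀ + (T₁ + + 4 * E₁)
    -- Here 3 M S = T₁ - T₀, where U₀ ≥ -T₀ because T₀ + 2 E₀ ≥ 0, and U₁ ≥ T₁ because E₁ ≥ 0. For
    -- the value 0 it suffices that U₀ and U₁ are nonnegative.
    total≤ = ⊔-elim (λ m → + 3 * (+ M * m) ≤ T₀ + + 4 * E₀ + (T₁ + + 4 * E₁)) 0ℤ S
      (linear (s≥0 ⊕ 2 ⊗ E₀≥0 ⊕ s₁≥0 ⊕ 2 ⊗ E₁≥0) (identity₀ (+ M) T₀ E₀ T₁ E₁))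
      (linear (2 ⊗ s≥0 ⊕ 4 ⊗ E₁≥0) (identityS (+ M) S T₀ E₀ E₁))
      where
      identity₀ : ∀ M T₀ E₀ T₁ E₁ → T₀ + + 2 * E₀ + + 2 * E₀ + (T₁ + + 2 * E₁) + + 2 * E₁
                  ≡ T₀ + + 4 * E₀ + (T₁ + + 4 * E₁) - + 3 * (M * 0ℤ)
      identity₀ = solve-∀
      identityS : ∀ M S T₀ E₀ E₁ → + 2 * (T₀ + + 2 * E₀) + + 4 * E₁
                  ≡ T₀ + + 4 * E₀ + (T₀ + + 3 * (M * S) + + 4 * E₁) - + 3 * (M * S)
      identityS = solve-∀
    identity : ∀ M k S p₀ p₁ p₂ e₀ e₁ e₂ T₀ E₀ m →
      + 3 * (+ 8 * (T₀ + + 2 * E₀ + M * p₀ + + 2 * e₀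
                   + (T₀ + + 2 * E₀ + (M * S + + 2 * e₀) + M * p₁ + + 2 * e₁)
                   + (T₀ + + 2 * E₀ + (M * S + + 2 * e₀) + (M * S + + 2 * e₁) + M * p₂ + + 2 * e₂)
                   + + 2 * e₁ + + 4 * e₂)
              + M * (+ 13 * m + + 37 - (+ 8 * (p₀ + p₁ + p₂) + + 2 * k)))
        + + 13 * (T₀ + + 4 * E₀ + (T₀ + + 3 * (M * S) + + 4 * (E₀ + (e₀ + (e₁ + e₂)))) - + 3 * (M * m))
        + + 192 * E₀ + + 24 * (T₀ + + 3 * (M * S) + + 2 * (E₀ + (e₀ + (e₁ + e₂))))
      ≡ + 61 * (T₀ + + 4 * E₀ + (T₀ + + 3 * (M * S) + + 4 * (E₀ + (e₀ + (e₁ + e₂))))) - + 3 * (M * (+ 2 * k - + 37))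
    identity = solve-∀

  -- Summation by parts: a level with item weight W costs W (U₁ − U₀), and the potential
  -- 366 · 2 W · U₀ carried into it makes both U₀ and U₁ available to pay for the level.
  levels-arithmetic : ∀ M W r k U₀ U₁ R → 0ℤ ≤ U₀ →
    + 3 * (+ M * (+ 2 * k - + 37)) ≤ + 61 * (U₀ + U₁) →
    + 3 * (+ 2 * k - + 37) * r * (+ 2 * + M) * + W ≤ + 488 * R + + 366 * (+ W * U₁) →
    + 3 * (+ 2 * k - + 37) * (1ℤ + r) * + M * (+ 2 * + W)
      ≤ + 488 * (+ W * (U₁ - U₀) + R) + + 366 * (+ 2 * + W * U₀)
  levels-arithmetic M W r k U₀ U₁ R U₀≥0 level rest =
    linear (gap rest ⊕ W ⊗ (2 ⊗ gap level ⊕ 122 ⊗ U₀≥0)) (identity (+ M) (+ W) r k U₀ U₁ R)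
    where
    identity : ∀ M W r k U₀ U₁ R →
      + 488 * R + + 366 * (W * U₁) - + 3 * (+ 2 * k - + 37) * r * (+ 2 * M) * W
        + W * (+ 2 * (+ 61 * (U₀ + U₁) - + 3 * (M * (+ 2 * k - + 37))) + + 122 * U₀)
      ≡ + 488 * (W * (U₁ - U₀) + R) + + 366 * (+ 2 * W * U₀)
        - + 3 * (+ 2 * k - + 37) * (1ℤ + r) * M * (+ 2 * W)
    identity = solve-∀

-- Charges, labels and costs along the list of items.

module Accounting {k : ℕ} where
  open import Data.Integer.Base hiding (suc)
  open import Data.Integer.Properties
  open import Data.Integer.Tactic.RingSolver using (solve-∀)
  open LinearArithmetic
  open Discrepancy
  open Levels
  open Costs

  Labelled : Set
  Labelled = List (Item k × ℕ)

  labels : Labelled → ℤ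
  labels l = sumℤ (map (λ a → + proj₂ a) l)

  labels-++ : ∀ l₁ l₂ → labels (l₁ ++ l₂) ≡ labels l₁ + labels l₂
  labels-++ l₁ l₂ = trans (cong sumℤ (List.map-++ _ l₁ l₂)) (sumℤ-++ (map _ l₁) _)

  labels≥0 : ∀ l → 0ℤ ≤ labels l
  labels≥0 []      = ≤-refl
  labels≥0 (a ∷ l) = +≤+ (ℕ.z≤n {proj₂ a}) ⊕ labels≥0 l

  module _ (z : ℕ → Symbol k → ℤ) where

    charge : Item k → ℤ
    charge (r , p) = pairSum (z r) p

    charges : List (Item k) → ℤ
    charges its = sumℤ (map charge its)

    charges-++ : ∀ xs ys → charges (xs ++ ys) ≡ charges xs + charges ys
    charges-++ xs ys = trans (cong sumℤ (List.map-++ charge xs ys)) (sumℤ-++ (map charge xs) _)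

    charges-replicate : ∀ M it → charges (replicate M it) ≡ + M * charge it
    charges-replicate zero    it = refl
    charges-replicate (suc M) it = trans (cong (_+_ (charge it)) (charges-replicate M it)) (identity (charge it) (+ M))
      where
      identity : ∀ c M → c + M * c ≡ (1ℤ + M) * c
      identity = solve-∀

    charges-pairs : ∀ r M ps → charges (concatMap (λ p → replicate M (r , p)) ps) ≡ + M * sumℤ (map (pairSum (z r)) ps)
    charges-pairs r M []       = sym (*-zeroʳ (+ M))
    charges-pairs r M (p ∷ ps) = begin
      charges (replicate M (r , p) ++ rest)                        ≡⟨ charges-++ (replicate M (r , p)) rest ⟩
      charges (replicate M (r , p)) + charges rest
        ≡⟨ cong₂ _+_ (charges-replicate M (r , p)) (charges-pairs r M ps) ⟩
      + M * pairSum (z r) p + + M * sumℤ (map (pairSum (z r)) ps)  ≡⟨ *-distribˡ-+ (+ M) (pairSum (z r) p) _ ⟨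
      + M * sumℤ (map (pairSum (z r)) (p ∷ ps))                    ∎
      where
      open ≡-Reasoning
      rest = concatMap (λ p → replicate M (r , p)) ps

    charges-class : ∀ c r M → charges (classItems k c r M) ≡ + M * symbolTotal (z r)
    charges-class c r M = trans (charges-pairs r M (classPairs c k)) (cong (_*_ (+ M)) (sumℤ-classPairs (z r) c))

    -- The increase of T + 2 E over a segment of the list.
    gain : Labelled → ℤ
    gain l = charges (map proj₁ l) + + 2 * labels l

    gain-++ : ∀ l₁ l₂ → gain (l₁ ++ l₂) ≡ gain l₁ + gain l₂
    gain-++ l₁ l₂ = trans (cong₂ (λ c e → c + + 2 * e)
        (trans (cong charges (List.map-++ proj₁ l₁ l₂)) (charges-++ (map proj₁ l₁) (map proj₁ l₂)))
        (labels-++ l₁ l₂))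
      (identity (charges (map proj₁ l₁)) (charges (map proj₁ l₂)) (labels l₁) (labels l₂))
      where
      identity : ∀ c₁ c₂ e₁ e₂ → c₁ + c₂ + + 2 * (e₁ + e₂) ≡ c₁ + + 2 * e₁ + (c₂ + + 2 * e₂)
      identity = solve-∀

    -- The value s of T + 2 E before the segment is a parameter, so that safety passes to a later
    -- segment once the gain in between is added to s.
    Safe : ℤ → Labelled → Set
    Safe s l = ∀ l₁ l₂ → l ≡ l₁ ++ l₂ → 0ℤ ≤ s + gain l₁

    safe-start : ∀ s l → Safe s l → 0ℤ ≤ s
    safe-start s l safe = subst (0ℤ ≤_) (+-identityʳ s) (safe [] l refl)

    safe-++ˡ : ∀ s l₁ l₂ → Safe s (l₁ ++ l₂) → Safe s l₁
    safe-++ˡ s l₁ l₂ safe a b refl = safe a (b ++ l₂) (List.++-assoc a b l₂)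

    safe-++ʳ : ∀ s l₁ l₂ → Safe s (l₁ ++ l₂) → Safe (s + gain l₁) l₂
    safe-++ʳ s l₁ l₂ safe a b refl = subst (0ℤ ≤_)
      (trans (cong (_+_ s) (gain-++ l₁ a)) (sym (+-assoc s (gain l₁) (gain a))))
      (safe (l₁ ++ a) b (sym (List.++-assoc l₁ a b)))

    -- At the boundaries between pairs the charge is M times a prefix sum of the pairs. Safety at
    -- the boundary with the lowest prefix sum gives the bound; the labels after this boundary are
    -- nonnegative and only help.
    class-bound : ∀ r M ps l s → map proj₁ l ≡ concatMap (λ p → replicate M (r , p)) ps → Safe s l →
                  0ℤ ≤ s + + M * minPrefix (map (pairSum (z r)) ps) + + 2 * labels l
    class-bound r M [] [] s eq safe = linear (safe-start s [] safe) (identity s (+ M))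
      where
      identity : ∀ s M → s ≡ s + M * 0ℤ + + 2 * 0ℤ - 0ℤ
      identity = solve-∀
    class-bound r M (p ∷ ps) l s eq safe
      with l₁ , l₂ , refl , eq₁ , eq₂ ← map-++⁻ proj₁ l {replicate M (r , p)} eq =
      ⊓-elim (λ m → 0ℤ ≤ s + + M * m + + 2 * labels (l₁ ++ l₂)) 0ℤ (c + m)
        (linear (safe-start s (l₁ ++ l₂) safe ⊕ 2 ⊗ labels≥0 (l₁ ++ l₂)) (identity₀ s (+ M) (labels (l₁ ++ l₂))))
        (subst (0ℤ ≤_) later (class-bound r M ps l₂ (s + gain l₁) eq₂ (safe-++ʳ s l₁ l₂ safe)))
      where
      c m : ℤ
      c = pairSum (z r) p
      m = minPrefix (map (pairSum (z r)) ps)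
      identity₀ : ∀ s M e → s + + 2 * e ≡ s + M * 0ℤ + + 2 * e - 0ℤ
      identity₀ = solve-∀
      identity₁ : ∀ s M c e₁ m e₂ → s + (M * c + + 2 * e₁) + M * m + + 2 * e₂ ≡ s + M * (c + m) + + 2 * (e₁ + e₂)
      identity₁ = solve-∀
      later : s + gain l₁ + + M * m + + 2 * labels l₂ ≡ s + + M * (c + m) + + 2 * labels (l₁ ++ l₂)
      later = trans
        (cong (λ t → s + (t + + 2 * labels l₁) + + M * m + + 2 * labels l₂)
          (trans (cong charges eq₁) (charges-replicate M (r , p))))
        (trans (identity₁ s (+ M) c (labels l₁) m (labels l₂))
          (cong (λ e → s + + M * (c + m) + + 2 * e) (sym (labels-++ l₁ l₂))))

    charges-level : ∀ r M → charges (levelItems k r M) ≡ + 3 * (+ M * symbolTotal (z r))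
    charges-level r M = begin
      charges (levelItems k r M)
        ≡⟨ charges-++ (classItems k 0F r M) _ ⟩
      charges (classItems k 0F r M) + charges (classItems k 1F r M ++ classItems k 2F r M)
        ≡⟨ cong (_+_ (charges (classItems k 0F r M))) (charges-++ (classItems k 1F r M) _) ⟩
      charges (classItems k 0F r M) + (charges (classItems k 1F r M) + charges (classItems k 2F r M))
        ≡⟨ cong₂ _+_ (charges-class 0F r M) (cong₂ _+_ (charges-class 1F r M) (charges-class 2F r M)) ⟩
      t + (t + t)
        ≡⟨ identity t ⟩
      + 3 * t ∎
      where
      open ≡-Reasoning
      t = + M * symbolTotal (z r)
      identity : ∀ t → t + (t + t) ≡ + 3 * t
      identity = solve-∀

    module _ (odd : ∀ r s → Odd (z r s)) (z≥-1 : ∀ r s → -1ℤ ≤ z r s) where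

      level-bound : ∀ r M l T₀ E₀ → map proj₁ l ≡ levelItems k r M → 0ℤ ≤ E₀ → Safe (T₀ + + 2 * E₀) l →
        + 3 * (+ M * (+ 2 * + k - + 37))
          ≤ + 61 * (T₀ + + 4 * E₀ + (T₀ + charges (map proj₁ l) + + 4 * (E₀ + labels l)))
      level-bound r M l T₀ E₀ eq E₀≥0 safe
        with l₀ , l₁₂ , refl , eq₀ , eq₁₂ ← map-++⁻ proj₁ l {classItems k 0F r M} eq
        with l₁ , l₂ , refl , eq₁ , eq₂ ← map-++⁻ proj₁ l₁₂ {classItems k 1F r M} eq₁₂
        = subst₂ (λ C E → + 3 * (+ M * (+ 2 * + k - + 37)) ≤ + 61 * (T₀ + + 4 * E₀ + (T₀ + C + + 4 * (E₀ + E))))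
            (sym charges≡) (sym labels≡) (level-arithmetic M (+ k) S _ _ _ (labels l₀) (labels l₁) (labels l₂) T₀ E₀
            E₀≥0 (labels≥0 l₀) (labels≥0 l₁) (labels≥0 l₂) (safe-start s l′ safe)
            final
            (class-bound r M (classPairs 0F k) l₀ s eq₀ safe₀)
            (subst (λ t → 0ℤ ≤ s + t + + M * lowestPair (z r) 1F + + 2 * labels l₁) (gain-class 0F l₀ eq₀)
              (class-bound r M (classPairs 1F k) l₁ (s + gain l₀) eq₁ safe₁))
            (subst₂ (λ t u → 0ℤ ≤ s + t + u + + M * lowestPair (z r) 2F + + 2 * labels l₂) (gain-class 0F l₀ eq₀) (gain-class 1F l₁ eq₁)
              (class-bound r M (classPairs 2F k) l₂ (s + gain l₀ + gain l₁) eq₂ safe₂))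
            (lowestPair-low (z r) (odd r) (z≥-1 r)))
        where
        l′ : Labelled
        l′ = l₀ ++ l₁ ++ l₂
        s S : ℤ
        s = T₀ + + 2 * E₀
        S = symbolTotal (z r)
        safe₀ = safe-++ˡ s l₀ (l₁ ++ l₂) safe
        safe₁₂ = safe-++ʳ s l₀ (l₁ ++ l₂) safe
        safe₁ = safe-++ˡ (s + gain l₀) l₁ l₂ safe₁₂
        safe₂ = safe-++ʳ (s + gain l₀) l₁ l₂ safe₁₂
        gain-class : ∀ c l → map proj₁ l ≡ classItems k c r M → gain l ≡ + M * S + + 2 * labels l
        gain-class c l eq = cong (λ t → t + + 2 * labels l) (trans (cong charges eq) (charges-class c r M))
        charges≡ : charges (map proj₁ l′) ≡ + 3 * (+ M * S)
        charges≡ = trans (cong charges eq) (charges-level r M)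
        labels≡ : labels l′ ≡ labels l₀ + (labels l₁ + labels l₂)
        labels≡ = trans (labels-++ l₀ (l₁ ++ l₂)) (cong (_+_ (labels l₀)) (labels-++ l₁ l₂))
        identity : ∀ T₀ E₀ C E → T₀ + + 2 * E₀ + (C + + 2 * E) ≡ T₀ + C + + 2 * (E₀ + E)
        identity = solve-∀
        final : 0ℤ ≤ T₀ + + 3 * (+ M * S) + + 2 * (E₀ + (labels l₀ + (labels l₁ + labels l₂)))
        final = subst₂ (λ C E → 0ℤ ≤ T₀ + C + + 2 * (E₀ + E)) charges≡ labels≡
          (subst (0ℤ ≤_) (identity T₀ E₀ (charges (map proj₁ l′)) (labels l′)) (safe l′ [] (sym (List.++-identityʳ l′))))

    -- The factor after the weight is the increment of U = T + 4 E. On a single level all weights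
    -- agree, so a level costs its weight times the increase of U.
    cost : Labelled → ℤ
    cost l = sumℤ (map (λ a → + (2 ℕ.^ proj₁ (proj₁ a)) * (charge (proj₁ a) + + 4 * + proj₂ a)) l)

    cost-++ : ∀ l₁ l₂ → cost (l₁ ++ l₂) ≡ cost l₁ + cost l₂
    cost-++ l₁ l₂ = trans (cong sumℤ (List.map-++ _ l₁ l₂)) (sumℤ-++ (map _ l₁) _)

    cost-level : ∀ r l → All (λ it → proj₁ it ≡ r) (map proj₁ l) →
                 cost l ≡ + (2 ℕ.^ r) * (charges (map proj₁ l) + + 4 * labels l)
    cost-level r []      []           = sym (*-zeroʳ (+ (2 ℕ.^ r)))
    cost-level r (a ∷ l) (refl ∷ all) = trans (cong (_+_ (W * (c + + 4 * d))) (cost-level r l all))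
      (identity W c d (charges (map proj₁ l)) (labels l))
      where
      W c d : ℤ
      W = + (2 ℕ.^ r)
      c = charge (proj₁ a)
      d = + proj₂ a
      identity : ∀ W c d C E → W * (c + + 4 * d) + W * (C + + 4 * E) ≡ W * (c + C + + 4 * (d + E))
      identity = solve-∀

    module _ (odd : ∀ r s → Odd (z r s)) (z≥-1 : ∀ r s → -1ℤ ≤ z r s) where

      -- Induction on the number r of levels. Doubling the copies while halving the size leaves M ·
      -- 2 ^ r unchanged, so every level contributes the same amount. The last term is the potential
      -- of U = T₀ + 4 E₀ on entry; it vanishes for the whole list, where T₀ = E₀ = 0.
      cost-bound : ∀ r M l T₀ E₀ → map proj₁ l ≡ items k r M → 0ℤ ≤ E₀ → Safe (T₀ + + 2 * E₀) l →
        + 3 * (+ 2 * + k - + 37) * + r * + M * + (2 ℕ.^ r)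
          ≤ + 488 * cost l + + 366 * (+ (2 ℕ.^ r) * (T₀ + + 4 * E₀))
      cost-bound zero M [] T₀ E₀ eq E₀≥0 safe =
        linear (366 ⊗ (safe-start (T₀ + + 2 * E₀) [] safe ⊕ 2 ⊗ E₀≥0)) (identity (+ k) (+ M) T₀ E₀)
        where
        identity : ∀ k M T₀ E₀ → + 366 * (T₀ + + 2 * E₀ + + 2 * E₀)
          ≡ + 488 * 0ℤ + + 366 * (1ℤ * (T₀ + + 4 * E₀)) - + 3 * (+ 2 * k - + 37) * 0ℤ * M * 1ℤ
        identity = solve-∀
      cost-bound (suc r) M l T₀ E₀ eq E₀≥0 safe
        with l₁ , l₂ , refl , eq₁ , eq₂ ← map-++⁻ proj₁ l {levelItems k r M} eq
        = subst₂ (λ V R → + 3 * (+ 2 * + k - + 37) * (1ℤ + + r) * + M * V ≤ + 488 * R + + 366 * (V * U₀))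
            (sym (pos-* 2 (2 ℕ.^ r))) (cost≡ l₁ l₂ eq₁)
            (levels-arithmetic M (2 ℕ.^ r) (+ r) (+ k) U₀ U₁ (cost l₂) U₀≥0
              (level-bound odd z≥-1 r M l₁ T₀ E₀ eq₁ E₀≥0 (safe-++ˡ s l₁ l₂ safe))
              (subst (λ m → + 3 * (+ 2 * + k - + 37) * + r * m * + (2 ℕ.^ r) ≤ + 488 * cost l₂ + + 366 * (+ (2 ℕ.^ r) * U₁))
                (pos-* 2 M) (cost-bound r (2 ℕ.* M) l₂ T₁ E₁ eq₂ (E₀≥0 ⊕ labels≥0 l₁)
                (subst (λ s → Safe s l₂) (regroup T₀ E₀ (charges (map proj₁ l₁)) (labels l₁)) (safe-++ʳ s l₁ l₂ safe)))))
        where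
        s U₀ T₁ E₁ U₁ : ℤ
        s  = T₀ + + 2 * E₀
        U₀ = T₀ + + 4 * E₀
        T₁ = T₀ + charges (map proj₁ l₁)
        E₁ = E₀ + labels l₁
        U₁ = T₁ + + 4 * E₁
        regroup : ∀ T₀ E₀ C E → T₀ + + 2 * E₀ + (C + + 2 * E) ≡ T₀ + C + + 2 * (E₀ + E)
        regroup = solve-∀
        U₀≥0 : 0ℤ ≤ U₀
        U₀≥0 = linear (safe-start s (l₁ ++ l₂) safe ⊕ 2 ⊗ E₀≥0) (identity T₀ E₀)
          where
          identity : ∀ T₀ E₀ → T₀ + + 2 * E₀ + + 2 * E₀ ≡ T₀ + + 4 * E₀ - 0ℤ
          identity = solve-∀
        cost≡ : ∀ l₁ l₂ → map proj₁ l₁ ≡ levelItems k r M →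
          + (2 ℕ.^ r) * (T₀ + charges (map proj₁ l₁) + + 4 * (E₀ + labels l₁) - (T₀ + + 4 * E₀)) + cost l₂ ≡ cost (l₁ ++ l₂)
        cost≡ l₁ l₂ eq₁ = trans
          (cong (_+ cost l₂) (trans (identity (+ (2 ℕ.^ r)) T₀ (charges (map proj₁ l₁)) E₀ (labels l₁))
            (sym (cost-level r l₁ (subst (All _) (sym eq₁) (levelItems-level r M))))))
          (sym (cost-++ l₁ l₂))
          where
          identity : ∀ W T₀ C E₀ E → W * (T₀ + C + + 4 * (E₀ + E) - (T₀ + + 4 * E₀)) ≡ W * (C + + 4 * E)
          identity = solve-∀

-- Finite sums and the covering condition.

⟦_⟧ : Bool → ℕ
⟦ b ⟧ = if b then 1 else 0

∑ : ∀ {A : Set} → List A → (A → ℕ) → ℕ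
∑ xs f = ℕ.sum (map f xs)

module Counting where
  open import Data.Nat.Base
  open import Data.Nat.Properties
  open import Data.Nat.Tactic.RingSolver using (solve-∀)

  module _ {A : Set} where

    ∑-cong : ∀ xs {f g : A → ℕ} → (∀ x → f x ≡ g x) → ∑ xs f ≡ ∑ xs g
    ∑-cong xs f≗g = cong ℕ.sum (List.map-cong f≗g xs)

    ∑-mono : ∀ xs {f g : A → ℕ} → (∀ x → f x ≤ g x) → ∑ xs f ≤ ∑ xs g
    ∑-mono []       f≤g = z≤n
    ∑-mono (x ∷ xs) f≤g = +-mono-≤ (f≤g x) (∑-mono xs f≤g)

    ∑-++ : ∀ xs ys (f : A → ℕ) → ∑ (xs ++ ys) f ≡ ∑ xs f + ∑ ys f
    ∑-++ xs ys f = trans (cong ℕ.sum (List.map-++ f xs ys)) (ℕ.sum-++ (map f xs) (map f ys))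

    ∑-zero : ∀ xs → ∑ {A} xs (λ _ → 0) ≡ 0
    ∑-zero []       = refl
    ∑-zero (x ∷ xs) = ∑-zero xs

    ∑-one : ∀ xs → ∑ {A} xs (λ _ → 1) ≡ length xs
    ∑-one []       = refl
    ∑-one (x ∷ xs) = cong suc (∑-one xs)

    ∑-+ : ∀ xs (f g : A → ℕ) → ∑ xs (λ x → f x + g x) ≡ ∑ xs f + ∑ xs g
    ∑-+ []       f g = refl
    ∑-+ (x ∷ xs) f g = trans (cong (_+_ (f x + g x)) (∑-+ xs f g)) (identity (f x) (g x) (∑ xs f) (∑ xs g))
      where
      identity : ∀ a b c d → a + b + (c + d) ≡ a + c + (b + d)
      identity = solve-∀

    ∑-* : ∀ c xs (f : A → ℕ) → ∑ xs (λ x → c * f x) ≡ c * ∑ xs f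
    ∑-* c []       f = sym (*-zeroʳ c)
    ∑-* c (x ∷ xs) f = trans (cong (_+_ (c * f x)) (∑-* c xs f)) (sym (*-distribˡ-+ c (f x) (∑ xs f)))

    ∑-filter : ∀ {P : Pred A 0ℓ} (P? : Decidable P) xs f →
               ∑ (filter P? xs) f ≡ ∑ xs (λ x → ⟦ does (P? x) ⟧ * f x)
    ∑-filter P? []       f = refl
    ∑-filter P? (x ∷ xs) f with does (P? x)
    ... | true  = cong₂ _+_ (sym (+-identityʳ (f x))) (∑-filter P? xs f)
    ... | false = ∑-filter P? xs f

    length-filter : ∀ {P : Pred A 0ℓ} (P? : Decidable P) xs →
                    length (filter P? xs) ≡ ∑ xs (λ x → ⟦ does (P? x) ⟧)
    length-filter P? []       = refl
    length-filter P? (x ∷ xs) with does (P? x)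
    ... | true  = cong suc (length-filter P? xs)
    ... | false = length-filter P? xs

    ∑-comprehension : ∀ {P : Pred A 0ℓ} (P? : Decidable P) xs f →
                      ∑ (comprehension P? xs) (f ∘ value) ≡ ∑ xs (λ x → ⟦ does (P? x) ⟧ * f x)
    ∑-comprehension P? []       f = refl
    ∑-comprehension P? (x ∷ xs) f with P? x
    ... | yes _ = cong₂ _+_ (sym (+-identityʳ (f x))) (∑-comprehension P? xs f)
    ... | no  _ = ∑-comprehension P? xs f

    ∑-map : ∀ {B : Set} (g : B → A) xs (f : A → ℕ) → ∑ (map g xs) f ≡ ∑ xs (f ∘ g)
    ∑-map g xs f = cong ℕ.sum (sym (List.map-∘ xs))

    ∑-tabulate : ∀ {n} (g : Fin n → A) (f : A → ℕ) → ∑ (tabulate g) f ≡ ∑ (allFin n) (f ∘ g)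
    ∑-tabulate g f = cong ℕ.sum (trans (List.map-tabulate g f) (sym (List.map-tabulate id (f ∘ g))))

    ∑-lookup : ∀ xs (f : A → ℕ) → ∑ (allFin (length xs)) (f ∘ List.lookup xs) ≡ ∑ xs f
    ∑-lookup xs f = trans (sym (∑-tabulate (List.lookup xs) f)) (cong (λ l → ∑ l f) (List.tabulate-lookup xs))

  ∑-swap : ∀ {A B : Set} (xs : List A) (ys : List B) (f : A → B → ℕ) →
           ∑ xs (λ x → ∑ ys (f x)) ≡ ∑ ys (λ y → ∑ xs (λ x → f x y))
  ∑-swap []       ys f = sym (∑-zero ys)
  ∑-swap (x ∷ xs) ys f = trans (cong (_+_ (∑ ys (f x))) (∑-swap xs ys f)) (sym (∑-+ ys (f x) _))

  ∑-suc : ∀ n (f : Fin (suc n) → ℕ) → ∑ (allFin (suc n)) f ≡ f Fin.zero + ∑ (allFin n) (f ∘ Fin.suc)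
  ∑-suc n f = cong (_+_ (f Fin.zero)) (∑-tabulate Fin.suc f)

  ∑-singleton : ∀ {n} (j : Fin n) (f : Fin n → ℕ) → ∑ (allFin n) (λ i → ⟦ does (j Fin.≟ i) ⟧ * f i) ≡ f j
  ∑-singleton {suc n} Fin.zero    f =
    trans (∑-suc n (λ i → ⟦ does (Fin.zero {n} Fin.≟ i) ⟧ * f i)) (trans (cong₂ _+_ (+-identityʳ (f Fin.zero)) (∑-zero (allFin n))) (+-identityʳ _))
  ∑-singleton {suc n} (Fin.suc j) f =
    trans (∑-suc n (λ i → ⟦ does (Fin.suc j Fin.≟ i) ⟧ * f i)) (∑-singleton j (f ∘ Fin.suc))

  ∑-prefix : ∀ {A : Set} {n} (g : Fin n → A) (f : A → ℕ) l₁ l₂ → tabulate g ≡ l₁ ++ l₂ →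
             ∑ l₁ f ≡ ∑ (allFin n) (λ i → ⟦ toℕ i <ᵇ length l₁ ⟧ * f (g i))
  ∑-prefix {n = n} g f [] l₂ eq = sym (∑-zero (allFin n))
  ∑-prefix {n = zero} g f (x ∷ l₁) l₂ ()
  ∑-prefix {n = suc n} g f (x ∷ l₁) l₂ eq =
    sym (trans (∑-suc n (λ i → ⟦ toℕ i <ᵇ suc (length l₁) ⟧ * f (g i))) (cong₂ _+_ (trans (+-identityʳ _) (cong f (List.∷-injectiveˡ eq)))
      (sym (∑-prefix (g ∘ Fin.suc) f l₁ l₂ (List.∷-injectiveʳ eq)))))

  -- Each item outside D is mapped by σ to an item of no smaller weight u.
  cover : ∀ {n} (D : Subset n) (σ : Complement D → Fin n) → (∀ j → σ j Fin.≤ value j) →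
          (X : Fin n → ℕ) → (∀ i → ∣ σ ⁻¹ i ∣ ≤ X i) →
          (u : Fin n → ℕ) → (∀ {i j} → i Fin.≤ j → u j ≤ u i) →
          ∑ (allFin n) u ≤ ∑ (allFin n) (λ i → u i * (X i + ⟦ does (i ∈? D) ⟧))
  cover {n} D σ σ≤ X σ⁻¹≤X u u-mono = begin
    ∑ is u                                                      ≡⟨ ∑-cong is split ⟩
    ∑ is (λ i → out i * u i + u i * ⟦ does (i ∈? D) ⟧)           ≡⟨ ∑-+ is _ _ ⟩
    ∑ is (λ i → out i * u i) + ∑ is inD                         ≡⟨ cong (_+ ∑ is inD) (∑-comprehension (λ i → ¬? (i ∈? D)) is u) ⟨
    ∑ (complement D) (u ∘ value) + ∑ is inD                     ≤⟨ +-monoˡ-≤ _ (∑-mono (complement D) (λ j → u-mono (σ≤ j))) ⟩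
    ∑ (complement D) (u ∘ σ) + ∑ is inD                         ≡⟨ cong (_+ ∑ is inD) fibres ⟩
    ∑ is (λ i → u i * ∣ σ ⁻¹ i ∣) + ∑ is inD                     ≤⟨ +-monoˡ-≤ _ (∑-mono is (λ i → *-monoʳ-≤ (u i) (σ⁻¹≤X i))) ⟩
    ∑ is (λ i → u i * X i) + ∑ is inD                           ≡⟨ ∑-+ is _ _ ⟨
    ∑ is (λ i → u i * X i + inD i)                              ≡⟨ ∑-cong is (λ i → sym (*-distribˡ-+ (u i) (X i) _)) ⟩
    ∑ is (λ i → u i * (X i + ⟦ does (i ∈? D) ⟧))                 ∎
    where
    open ≤-Reasoning
    is = allFin n
    out inD : Fin n → ℕ
    out i = ⟦ does (¬? (i ∈? D)) ⟧
    inD i = u i * ⟦ does (i ∈? D) ⟧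
    split : ∀ i → u i ≡ out i * u i + inD i
    split i with does (i ∈? D)
    ... | true  = sym (*-identityʳ (u i))
    ... | false = sym (trans (cong₂ _+_ (*-identityˡ (u i)) (*-zeroʳ (u i))) (+-identityʳ (u i)))
    fibres : ∑ (complement D) (u ∘ σ) ≡ ∑ is (λ i → u i * ∣ σ ⁻¹ i ∣)
    fibres = begin-equality
      ∑ (complement D) (u ∘ σ)
        ≡⟨ ∑-cong (complement D) (λ j → ∑-singleton (σ j) u) ⟨
      ∑ (complement D) (λ j → ∑ is (λ i → ⟦ does (σ j Fin.≟ i) ⟧ * u i))
        ≡⟨ ∑-swap (complement D) is _ ⟩
      ∑ is (λ i → ∑ (complement D) (λ j → ⟦ does (σ j Fin.≟ i) ⟧ * u i))
        ≡⟨ ∑-cong is (λ i → ∑-cong (complement D) (λ j → *-comm _ (u i))) ⟩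
      ∑ is (λ i → ∑ (complement D) (λ j → u i * ⟦ does (σ j Fin.≟ i) ⟧))
        ≡⟨ ∑-cong is (λ i → ∑-* (u i) (complement D) _) ⟩
      ∑ is (λ i → u i * ∑ (complement D) (λ j → ⟦ does (σ j Fin.≟ i) ⟧))
        ≡⟨ ∑-cong is (λ i → cong (u i *_) (length-filter (λ j → σ j Fin.≟ i) (complement D))) ⟨
      ∑ is (λ i → u i * ∣ σ ⁻¹ i ∣) ∎

  _≟ˢ_ : ∀ {n} (p q : Subset n) → Dec (p ≡ q)
  _≟ˢ_ = Vec.≡-dec Bool._≟_

  -- The enumeration of subsets lists each of them exactly once; this form lets a sum over all
  -- subsets collapse to the pattern of one symbol.
  ∑-subsets : ∀ n (q : Subset n) (f : Subset n → ℕ) → ∑ (subsets n) (λ p → ⟦ does (q ≟ˢ p) ⟧ * f p) ≡ f q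
  ∑-subsets zero    []      f = trans (+-identityʳ _) (+-identityʳ _)
  ∑-subsets (suc n) (b ∷ q) f = trans (∑-++ (map (outside ∷_) (subsets n)) _ _)
    (trans (cong₂ _+_ (∑-map (outside ∷_) (subsets n) _) (∑-map (inside ∷_) (subsets n) _)) (parts b))
    where
    parts : ∀ b → ∑ (subsets n) (λ p → ⟦ does ((b ∷ q) ≟ˢ (outside ∷ p)) ⟧ * f (outside ∷ p))
                  + ∑ (subsets n) (λ p → ⟦ does ((b ∷ q) ≟ˢ (inside ∷ p)) ⟧ * f (inside ∷ p)) ≡ f (b ∷ q)
    parts outside = trans (cong₂ _+_ (∑-subsets n q (f ∘ (outside ∷_))) (∑-zero (subsets n))) (+-identityʳ _)
    parts inside  = cong₂ _+_ (∑-zero (subsets n)) (∑-subsets n q (f ∘ (inside ∷_)))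

  ∈?-lookup : ∀ {n} (i : Fin n) (p : Subset n) → does (i ∈? p) ≡ Vec.lookup p i
  ∈?-lookup Fin.zero    (inside  ∷ p) = refl
  ∈?-lookup Fin.zero    (outside ∷ p) = refl
  ∈?-lookup (Fin.suc i) (_       ∷ p) = ∈?-lookup i p

-- Incidence of symbols and items, and the number of items.

module Incidence {k : ℕ} where
  open import Data.Nat.Base
  open import Data.Nat.Properties
  open import Data.Nat.Tactic.RingSolver using (solve-∀)
  open Counting

  Tagged : Set
  Tagged = ℕ × Symbol k

  infix 4 _≟ᵛ_ _≟ˢʸ_

  _≟ᵛ_ : ∀ {k} → DecidableEquality (Vec (Fin 3) k)
  _≟ᵛ_ = Vec.≡-dec Fin._≟_

  _≟ˢʸ_ : DecidableEquality (Symbol k)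
  _≟ˢʸ_ = Maybe.≡-dec _≟ᵛ_

  contains : Tagged → Item k → Bool
  contains (r , s) (r′ , s₁ , s₂) = does (r ℕ.≟ r′) ∧ (does (s ≟ˢʸ s₁) ∨ does (s ≟ˢʸ s₂))

  δ : Symbol k → Symbol k → ℕ
  δ s s′ = ⟦ does (s ≟ˢʸ s′) ⟧

  -- The counting form of being a permutation. Only the block that starts with b contributes, and
  -- the nine cases find its place in the order.
  ∑-perm : ∀ c k (w : Vec (Fin 3) k) → ∑ (perm c k) (λ w′ → ⟦ does (w ≟ᵛ w′) ⟧) ≡ 1
  ∑-perm c zero    []      = refl
  ∑-perm c (suc k) (b ∷ w) = go c b
    where
    part : Fin 3 → Fin 3 → ℕ
    part b b′ = ∑ (perm c k) (λ w′ → ⟦ does ((b ∷ w) ≟ᵛ (b′ ∷ w′)) ⟧)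
    three : ∀ b b₁ b₂ b₃ →
            ∑ (concatMap (λ b → map (b ∷_) (perm c k)) (b₁ ∷ b₂ ∷ b₃ ∷ [])) (λ w′ → ⟦ does ((b ∷ w) ≟ᵛ w′) ⟧)
            ≡ part b b₁ + (part b b₂ + part b b₃)
    three b b₁ b₂ b₃ = begin
      ∑ (xs b₁ ++ xs b₂ ++ xs b₃ ++ []) f            ≡⟨ ∑-++ (xs b₁) _ f ⟩
      ∑ (xs b₁) f + ∑ (xs b₂ ++ xs b₃ ++ []) f       ≡⟨ cong (∑ (xs b₁) f +_) (∑-++ (xs b₂) _ f) ⟩
      ∑ (xs b₁) f + (∑ (xs b₂) f + ∑ (xs b₃ ++ []) f)
        ≡⟨ cong (λ l → ∑ (xs b₁) f + (∑ (xs b₂) f + ∑ l f)) (List.++-identityʳ (xs b₃)) ⟩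
      ∑ (xs b₁) f + (∑ (xs b₂) f + ∑ (xs b₃) f)
        ≡⟨ cong₂ _+_ (∑-map _ (perm c k) f) (cong₂ _+_ (∑-map _ (perm c k) f) (∑-map _ (perm c k) f)) ⟩
      part b b₁ + (part b b₂ + part b b₃)            ∎
      where
      open ≡-Reasoning
      xs : Fin 3 → List (Vec (Fin 3) (suc k))
      xs b = map (b ∷_) (perm c k)
      f : Vec (Fin 3) (suc k) → ℕ
      f w′ = ⟦ does ((b ∷ w) ≟ᵛ w′) ⟧
    same : ∀ b → part b b ≡ 1
    same 0F = ∑-perm c k w
    same 1F = ∑-perm c k w
    same 2F = ∑-perm c k w
    zeros : ∑ (perm c k) (λ _ → 0) ≡ 0
    zeros = ∑-zero (perm c k)
    first : ∀ {x y z} → x ≡ 1 → y ≡ 0 → z ≡ 0 → x + (y + z) ≡ 1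
    first refl refl refl = refl
    second : ∀ {x y z} → x ≡ 0 → y ≡ 1 → z ≡ 0 → x + (y + z) ≡ 1
    second refl refl refl = refl
    third : ∀ {x y z} → x ≡ 0 → y ≡ 0 → z ≡ 1 → x + (y + z) ≡ 1
    third refl refl refl = refl
    go : ∀ c′ b → ∑ (concatMap (λ b → map (b ∷_) (perm c k)) (order c′)) (λ w′ → ⟦ does ((b ∷ w) ≟ᵛ w′) ⟧) ≡ 1
    go 0F 0F = trans (three 0F 0F 1F 2F) (first (same 0F) zeros zeros)
    go 0F 1F = trans (three 1F 0F 1F 2F) (second zeros (same 1F) zeros)
    go 0F 2F = trans (three 2F 0F 1F 2F) (third zeros zeros (same 2F))
    go 1F 0F = trans (three 0F 2F 0F 1F) (second zeros (same 0F) zeros)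
    go 1F 1F = trans (three 1F 2F 0F 1F) (third zeros zeros (same 1F))
    go 1F 2F = trans (three 2F 2F 0F 1F) (first (same 2F) zeros zeros)
    go 2F 0F = trans (three 0F 1F 2F 0F) (third zeros zeros (same 0F))
    go 2F 1F = trans (three 1F 1F 2F 0F) (first (same 1F) zeros zeros)
    go 2F 2F = trans (three 2F 1F 2F 0F) (second zeros (same 2F) zeros)

  ∑-just : ∀ c s → ∑ (map just (perm c k)) (δ s) + δ s nothing ≡ 1
  ∑-just c (just w) = trans (+-identityʳ _) (trans (∑-map just (perm c k) (δ (just w))) (∑-perm c k w))
  ∑-just c nothing  = cong (_+ 1) (trans (∑-map just (perm c k) (δ nothing)) (∑-zero (perm c k)))

  ∑-pairUp : ∀ {A : Set} (f : A → ℕ) {xs} e → OddLength xs →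
             ∑ (pairUp xs e) (λ p → f (proj₁ p) + f (proj₂ p)) ≡ ∑ xs f + f e
  ∑-pairUp f e (one {x}) = identity (f x) (f e)
    where
    identity : ∀ x e → x + e + 0 ≡ x + 0 + e
    identity = solve-∀
  ∑-pairUp f e (_+2 {x} {y} {xs} o) = trans (cong (f x + f y +_) (∑-pairUp f e o)) (identity (f x) (f y) (∑ xs f) (f e))
    where
    identity : ∀ x y s e → x + y + (s + e) ≡ x + (y + s) + e
    identity = solve-∀

  δ² : Symbol k → Symbol k × Symbol k → ℕ
  δ² s (a , b) = δ s a + δ s b

  ∑-classPairs : ∀ c s → ∑ (classPairs c k) (δ² s) ≡ 1
  ∑-classPairs c s = trans (∑-pairUp (δ s) nothing (oddLength-map just (oddLength-perm c k))) (∑-just c s)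

  ∈⇒≤∑ : ∀ {A : Set} (f : A → ℕ) {x xs} → x ∈ xs → f x ≤ ∑ xs f
  ∈⇒≤∑ f (here refl) = m≤m+n _ _
  ∈⇒≤∑ f (there x∈)  = ≤-trans (∈⇒≤∑ f x∈) (m≤n+m _ _)

  δ-refl : ∀ s → δ s s ≡ 1
  δ-refl s = cong ⟦_⟧ (dec-true (s ≟ˢʸ s) refl)

  -- A pair of equal symbols would count its symbol twice, but each symbol occurs only once in a
  -- class.
  classPairs-distinct : ∀ c → All (λ p → proj₁ p ≢ proj₂ p) (classPairs c k)
  classPairs-distinct c = All.tabulate λ {p} p∈ → distinct p p∈
    where
    distinct : ∀ p → p ∈ classPairs c k → proj₁ p ≢ proj₂ p
    distinct (s , _) p∈ refl = contradiction
      (subst₂ _≤_ (cong₂ _+_ (δ-refl s) (δ-refl s)) (∑-classPairs c s) (∈⇒≤∑ (δ² s) p∈))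
      λ { (s≤s ()) }

  Proper : ℕ → Item k → Set
  Proper L (r , s , s′) = r < L × s ≢ s′

  classItems-proper : ∀ c r M → All (Proper (suc r)) (classItems k c r M)
  classItems-proper c r M = go (classPairs-distinct c)
    where
    go : ∀ {ps} → All (λ p → proj₁ p ≢ proj₂ p) ps → All (Proper (suc r)) (concatMap (λ p → replicate M (r , p)) ps)
    go []         = []
    go (ne ∷ nes) = All.++⁺ (All.replicate⁺ M (≤-refl , ne)) (go nes)

  items-proper : ∀ L M → All (Proper L) (items k L M)
  items-proper zero    M = []
  items-proper (suc r) M = All.++⁺
    (All.++⁺ (classItems-proper 0F r M) (All.++⁺ (classItems-proper 1F r M) (classItems-proper 2F r M)))
    (All.map (λ { (r< , ne) → m<n⇒m<1+n r< , ne }) (items-proper r (2 * M)))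

  Descending : List (Item k) → Set
  Descending = AllPairs (λ a b → proj₁ b ≤ proj₁ a)

  items-descending : ∀ L M → Descending (items k L M)
  items-descending zero    M = []
  items-descending (suc r) M = AllPairs.++⁺ (constant (levelItems-level r M)) (items-descending r (2 * M))
    (All.map (λ { refl → All.map (λ { (r< , _) → <⇒≤ r< }) (items-proper r (2 * M)) }) (levelItems-level r M))
    where
    constant : ∀ {l} → All (λ it → proj₁ it ≡ r) l → Descending l
    constant []           = []
    constant (refl ∷ all) = All.map ≤-reflexive all ∷ constant all

  lookup-descending : ∀ {l} → Descending l → ∀ {i j} → i Fin.≤ j → proj₁ (List.lookup l j) ≤ proj₁ (List.lookup l i)
  lookup-descending (_ ∷ _)     {Fin.zero}  {Fin.zero}  _   = ≤-refl
  lookup-descending (all ∷ _)   {Fin.zero}  {Fin.suc j} _   = All.lookup all (∈-lookup j)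
  lookup-descending (_ ∷ desc)  {Fin.suc i} {Fin.suc j} i≤j = lookup-descending desc (s≤s⁻¹ i≤j)

  ∑-replicate : ∀ {A : Set} M (x : A) f → ∑ (replicate M x) f ≡ M * f x
  ∑-replicate zero    x f = refl
  ∑-replicate (suc M) x f = cong (f x +_) (∑-replicate M x f)

  ∑-classItems : ∀ c r M f → ∑ (classItems k c r M) f ≡ M * ∑ (classPairs c k) (λ p → f (r , p))
  ∑-classItems c r M f = go (classPairs c k)
    where
    go : ∀ ps → ∑ (concatMap (λ p → replicate M (r , p)) ps) f ≡ M * ∑ ps (λ p → f (r , p))
    go []       = sym (*-zeroʳ M)
    go (p ∷ ps) = trans (∑-++ (replicate M (r , p)) _ f)
      (trans (cong₂ _+_ (∑-replicate M (r , p) f) (go ps)) (sym (*-distribˡ-+ M (f (r , p)) _)))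

  ∑-levelItems : ∀ r M f {t} → (∀ c → ∑ (classPairs c k) (λ p → f (r , p)) ≡ t) → ∑ (levelItems k r M) f ≡ 3 * M * t
  ∑-levelItems r M f {t} eq = begin
    ∑ (levelItems k r M) f
      ≡⟨ trans (∑-++ (classItems k 0F r M) _ f) (cong (∑ (classItems k 0F r M) f +_) (∑-++ (classItems k 1F r M) _ f)) ⟩
    ∑ (classItems k 0F r M) f + (∑ (classItems k 1F r M) f + ∑ (classItems k 2F r M) f)
      ≡⟨ cong₂ _+_ (part 0F) (cong₂ _+_ (part 1F) (part 2F)) ⟩
    M * t + (M * t + M * t)
      ≡⟨ identity M t ⟩
    3 * M * t ∎
    where
    open ≡-Reasoning
    part : ∀ c → ∑ (classItems k c r M) f ≡ M * t
    part c = trans (∑-classItems c r M f) (cong (M *_) (eq c))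
    identity : ∀ M t → M * t + (M * t + M * t) ≡ 3 * M * t
    identity = solve-∀

  agrees : Tagged → Tagged → ℕ
  agrees (r , s) (r′ , s′) = ⟦ does (r ℕ.≟ r′) ∧ does (s ≟ˢʸ s′) ⟧

  contains-agrees : ∀ j {r s₁ s₂} → s₁ ≢ s₂ → ⟦ contains j (r , s₁ , s₂) ⟧ ≡ agrees j (r , s₁) + agrees j (r , s₂)
  contains-agrees (r′ , s) {r} {s₁} {s₂} s₁≢s₂ with does (r′ ℕ.≟ r)
  ... | false = refl
  ... | true with s ≟ˢʸ s₁ | s ≟ˢʸ s₂
  ...   | yes refl | yes refl = contradiction refl s₁≢s₂
  ...   | yes _    | no _     = refl
  ...   | no _     | yes _    = refl
  ...   | no _     | no _     = refl

  agrees-level : ∀ r s s′ → agrees (r , s) (r , s′) ≡ δ s s′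
  agrees-level r s s′ rewrite dec-true (r ℕ.≟ r) refl = refl

  contains-level : ∀ r s s₁ s₂ → s₁ ≢ s₂ → ⟦ contains (r , s) (r , s₁ , s₂) ⟧ ≡ δ s s₁ + δ s s₂
  contains-level r s s₁ s₂ s₁≢s₂ = trans (contains-agrees (r , s) s₁≢s₂) (cong₂ _+_ (agrees-level r s s₁) (agrees-level r s s₂))

  contains-other : ∀ {r r′} s p → r ≢ r′ → contains (r , s) (r′ , p) ≡ false
  contains-other {r} {r′} s p r≢r′ rewrite dec-false (r ℕ.≟ r′) r≢r′ = refl

  δ-sym : ∀ s s′ → δ s s′ ≡ δ s′ s
  δ-sym s s′ = cong ⟦_⟧ (does-⇔ (mk⇔ sym sym) (s ≟ˢʸ s′) (s′ ≟ˢʸ s))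

  levelSymbols : List (Symbol k)
  levelSymbols = map just (perm 0F k) ++ nothing ∷ []

  symbols : ℕ → List Tagged
  symbols zero    = []
  symbols (suc r) = map (r ,_) levelSymbols ++ symbols r

  ∑-levelSymbols : ∀ s → ∑ levelSymbols (λ s′ → δ s′ s) ≡ 1
  ∑-levelSymbols s = begin
    ∑ levelSymbols (λ s′ → δ s′ s)              ≡⟨ ∑-cong levelSymbols (λ s′ → δ-sym s′ s) ⟩
    ∑ levelSymbols (δ s)                        ≡⟨ ∑-++ (map just (perm 0F k)) _ (δ s) ⟩
    ∑ (map just (perm 0F k)) (δ s) + (δ s nothing + 0) ≡⟨ cong (∑ (map just (perm 0F k)) (δ s) +_) (+-identityʳ _) ⟩
    ∑ (map just (perm 0F k)) (δ s) + δ s nothing       ≡⟨ ∑-just 0F s ⟩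
    1                                           ∎
    where open ≡-Reasoning

  ∑-symbols-above : ∀ L {r} p → L ≤ r → ∑ (symbols L) (λ j → ⟦ contains j (r , p) ⟧) ≡ 0
  ∑-symbols-above zero    p L≤r = refl
  ∑-symbols-above (suc L) {r} p L<r = trans (∑-++ (map (L ,_) levelSymbols) _ _)
    (cong₂ _+_
      (trans (∑-map (L ,_) levelSymbols _)
        (trans (∑-cong levelSymbols (λ s → cong ⟦_⟧ (contains-other s p (<⇒≢ L<r)))) (∑-zero levelSymbols)))
      (∑-symbols-above L p (<⇒≤ L<r)))

  ∑-symbols : ∀ L it → Proper L it → ∑ (symbols L) (λ j → ⟦ contains j it ⟧) ≡ 2
  ∑-symbols (suc L) it@(r , s₁ , s₂) (r<1+L , s₁≢s₂) with r ℕ.≟ L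
  ... | yes refl = trans (∑-++ (map (r ,_) levelSymbols) _ _) (cong₂ _+_
    (begin
      ∑ (map (r ,_) levelSymbols) (λ j → ⟦ contains j it ⟧)  ≡⟨ ∑-map (r ,_) levelSymbols _ ⟩
      ∑ levelSymbols (λ s → ⟦ contains (r , s) it ⟧)         ≡⟨ ∑-cong levelSymbols (λ s → contains-level r s s₁ s₂ s₁≢s₂) ⟩
      ∑ levelSymbols (λ s → δ s s₁ + δ s s₂)                 ≡⟨ ∑-+ levelSymbols _ _ ⟩
      ∑ levelSymbols (λ s → δ s s₁) + ∑ levelSymbols (λ s → δ s s₂)
        ≡⟨ cong₂ _+_ (∑-levelSymbols s₁) (∑-levelSymbols s₂) ⟩
      2 ∎)
    (∑-symbols-above r (s₁ , s₂) ≤-refl))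
    where open ≡-Reasoning
  ... | no r≢L = trans (∑-++ (map (L ,_) levelSymbols) _ _) (cong₂ _+_
    (trans (∑-map (L ,_) levelSymbols _)
      (trans (∑-cong levelSymbols (λ s → cong ⟦_⟧ (contains-other s (s₁ , s₂) (r≢L ∘ sym)))) (∑-zero levelSymbols)))
    (∑-symbols L it (≤∧≢⇒< (s≤s⁻¹ r<1+L) r≢L , s₁≢s₂)))

  symbols-below : ∀ L → All (λ j → proj₁ j < L) (symbols L)
  symbols-below zero    = []
  symbols-below (suc r) = All.++⁺ (All.map⁺ (All.tabulate (λ _ → ≤-refl))) (All.map m<n⇒m<1+n (symbols-below r))

  weight : Item k → ℕ
  weight it = 2 ^ proj₁ it

  ∑-cong-All : ∀ {A : Set} {P : A → Set} {l} {f g : A → ℕ} → (∀ x → P x → f x ≡ g x) → All P l → ∑ l f ≡ ∑ l g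
  ∑-cong-All f≗g []        = refl
  ∑-cong-All f≗g (p ∷ all) = cong₂ _+_ (f≗g _ p) (∑-cong-All f≗g all)

  ∑-contains-level : ∀ r s M → ∑ (levelItems k r M) (λ it → ⟦ contains (r , s) it ⟧ * weight it) ≡ 3 * M * 2 ^ r
  ∑-contains-level r s M = ∑-levelItems r M _ λ c → begin
    ∑ (classPairs c k) (λ p → ⟦ contains (r , s) (r , p) ⟧ * 2 ^ r)
      ≡⟨ ∑-cong-All (λ { (s₁ , s₂) ne → trans (cong (_* 2 ^ r) (contains-level r s s₁ s₂ ne)) (*-comm (δ² s (s₁ , s₂)) (2 ^ r)) })
           (classPairs-distinct c) ⟩
    ∑ (classPairs c k) (λ p → 2 ^ r * δ² s p) ≡⟨ ∑-* (2 ^ r) (classPairs c k) (δ² s) ⟩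
    2 ^ r * ∑ (classPairs c k) (δ² s)         ≡⟨ cong (2 ^ r *_) (∑-classPairs c s) ⟩
    2 ^ r * 1                                 ≡⟨ *-identityʳ (2 ^ r) ⟩
    2 ^ r ∎
    where open ≡-Reasoning

  ∑-contains-other : ∀ {P : Item k → Set} {r} s l → (∀ it → P it → r ≢ proj₁ it) → All P l →
                     ∑ l (λ it → ⟦ contains (r , s) it ⟧ * weight it) ≡ 0
  ∑-contains-other s l r≢ all = trans
    (∑-cong-All (λ it p → cong (λ b → ⟦ b ⟧ * weight it) (contains-other s (proj₂ it) (r≢ it p))) all) (∑-zero l)

  -- On its level a symbol has three times as many items as there are copies, one group for each
  -- class. Copies times weight is the same on all levels, which makes all patterns equally large.
  -- The factor 2 avoids the exponent L - 1.
  ∑-contains : ∀ L M {r} s → r < L → 2 * ∑ (items k L M) (λ it → ⟦ contains (r , s) it ⟧ * weight it) ≡ 3 * M * 2 ^ L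
  ∑-contains (suc L) M {r} s r<1+L with r ℕ.≟ L
  ... | yes refl = trans
    (cong (2 *_) (trans (∑-++ (levelItems k r M) _ _) (cong₂ _+_ (∑-contains-level r s M)
      (∑-contains-other s (items k r (2 * M)) (λ _ p → <⇒≢ (proj₁ p) ∘ sym) (items-proper r (2 * M))))))
    (identity M (2 ^ r))
    where
    identity : ∀ M W → 2 * (3 * M * W + 0) ≡ 3 * M * (2 * W)
    identity = solve-∀
  ... | no r≢L = trans
    (cong (2 *_) (trans (∑-++ (levelItems k L M) _ _) (cong (_+ rest)
      (∑-contains-other s (levelItems k L M) (λ _ p → r≢L ∘ λ eq → trans eq p) (levelItems-level L M)))))
    (trans (∑-contains L (2 * M) s (≤∧≢⇒< (s≤s⁻¹ r<1+L) r≢L)) (identity M (2 ^ L)))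
    where
    rest = ∑ (items k L (2 * M)) (λ it → ⟦ contains (r , s) it ⟧ * weight it)
    identity : ∀ M W → 3 * (2 * M) * W ≡ 3 * M * (2 * W)
    identity = solve-∀

  length-perm : ∀ c k → length (perm c k) ≡ 3 ^ k
  length-perm c zero    = refl
  length-perm c (suc k) = go c
    where
    part : ∀ b → length (map (b ∷_) (perm c k)) ≡ 3 ^ k
    part b = trans (List.length-map (b ∷_) (perm c k)) (length-perm c k)
    three : ∀ b₁ b₂ b₃ → length (concatMap (λ b → map (b ∷_) (perm c k)) (b₁ ∷ b₂ ∷ b₃ ∷ [])) ≡ 3 ^ suc k
    three b₁ b₂ b₃ = trans (List.length-++ (map (b₁ ∷_) (perm c k))) (cong₂ _+_ (part b₁)
      (trans (List.length-++ (map (b₂ ∷_) (perm c k))) (cong₂ _+_ (part b₂)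
        (trans (List.length-++ (map (b₃ ∷_) (perm c k))) (cong (_+ 0) (part b₃))))))
    go : ∀ c′ → length (concatMap (λ b → map (b ∷_) (perm c k)) (order c′)) ≡ 3 ^ suc k
    go 0F = three 0F 1F 2F
    go 1F = three 2F 0F 1F
    go 2F = three 1F 2F 0F

  length-pairUp : ∀ {A : Set} {xs : List A} e → OddLength xs →
                  1 ≤ length (pairUp xs e) × length (pairUp xs e) ≤ length xs
  length-pairUp e one    = ≤-refl , ≤-refl
  length-pairUp e (o +2) = s≤s z≤n , s≤s (m≤n⇒m≤1+n (proj₂ (length-pairUp e o)))

  length-classPairs : ∀ c → 1 ≤ length (classPairs c k) × length (classPairs c k) ≤ 3 ^ k
  length-classPairs c with 1≤ , ≤len ← length-pairUp nothing (oddLength-map just (oddLength-perm c k))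
    = 1≤ , ≤-trans ≤len (≤-reflexive (trans (List.length-map just (perm c k)) (length-perm c k)))

  length-classItems : ∀ c r M → length (classItems k c r M) ≡ M * length (classPairs c k)
  length-classItems c r M = trans (sym (∑-one (classItems k c r M)))
    (trans (∑-classItems c r M _) (cong (M *_) (∑-one (classPairs c k))))

  length-levelItems≤ : ∀ r M → length (levelItems k r M) ≤ 3 * M * 3 ^ k
  length-levelItems≤ r M = begin
    length (levelItems k r M)
      ≡⟨ trans (List.length-++ (classItems k 0F r M)) (cong (length (classItems k 0F r M) +_) (List.length-++ (classItems k 1F r M))) ⟩
    length (classItems k 0F r M) + (length (classItems k 1F r M) + length (classItems k 2F r M))
      ≤⟨ +-mono-≤ (part 0F) (+-mono-≤ (part 1F) (part 2F)) ⟩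
    M * 3 ^ k + (M * 3 ^ k + M * 3 ^ k)
      ≡⟨ identity M (3 ^ k) ⟩
    3 * M * 3 ^ k ∎
    where
    open ≤-Reasoning
    part : ∀ c → length (classItems k c r M) ≤ M * 3 ^ k
    part c = ≤-trans (≤-reflexive (length-classItems c r M)) (*-monoʳ-≤ M (proj₂ (length-classPairs c)))
    identity : ∀ M t → M * t + (M * t + M * t) ≡ 3 * M * t
    identity = solve-∀

  -- The bounds for the levels form a geometric series; the summand 3 * M * 3 ^ k on the left makes
  -- the induction close.
  length-items≤ : ∀ L M → length (items k L M) + 3 * M * 3 ^ k ≤ 3 * M * 3 ^ k * 2 ^ L
  length-items≤ zero    M = ≤-reflexive (sym (*-identityʳ _))
  length-items≤ (suc L) M = begin
    length (levelItems k L M ++ items k L (2 * M)) + K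
      ≡⟨ cong (_+ K) (List.length-++ (levelItems k L M)) ⟩
    length (levelItems k L M) + length (items k L (2 * M)) + K
      ≤⟨ +-monoˡ-≤ K (+-monoˡ-≤ _ (length-levelItems≤ L M)) ⟩
    K + length (items k L (2 * M)) + K
      ≡⟨ identity₁ M (3 ^ k) (length (items k L (2 * M))) ⟩
    length (items k L (2 * M)) + 3 * (2 * M) * 3 ^ k
      ≤⟨ length-items≤ L (2 * M) ⟩
    3 * (2 * M) * 3 ^ k * 2 ^ L
      ≡⟨ identity₂ M (3 ^ k) (2 ^ L) ⟩
    K * 2 ^ suc L ∎
    where
    open ≤-Reasoning
    K = 3 * M * 3 ^ k
    identity₁ : ∀ M t l → 3 * M * t + l + 3 * M * t ≡ l + 3 * (2 * M) * t
    identity₁ = solve-∀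
    identity₂ : ∀ M t W → 3 * (2 * M) * t * W ≡ 3 * M * t * (2 * W)
    identity₂ = solve-∀

  -- No level is empty, which is enough to make the number of items exceed any given bound.
  ≤-length-items : ∀ L M → 1 ≤ M → L ≤ length (items k L M)
  ≤-length-items zero    M 1≤M = z≤n
  ≤-length-items (suc L) M 1≤M = begin
    1 + L                                              ≤⟨ +-mono-≤ nonempty (≤-length-items L (2 * M) (≤-trans 1≤M (m≤m+n M _))) ⟩
    length (levelItems k L M) + length (items k L (2 * M)) ≡⟨ List.length-++ (levelItems k L M) ⟨
    length (items k (suc L) M)                           ∎
    where
    open ≤-Reasoning
    nonempty : 1 ≤ length (levelItems k L M)
    nonempty = ≤-trans (*-mono-≤ 1≤M (proj₁ (length-classPairs 0F)))
      (≤-trans (≤-reflexive (sym (length-classItems 0F L M))) (List.length-++-≤ˡ (classItems k 0F L M)))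

-- Patterns of symbols, and the passage from patterns to symbols.

module Construction (k : ℕ) where
  open import Data.Nat.Base
  open import Data.Nat.Properties
  open import Data.Nat.Tactic.RingSolver using (solve-∀)
  open Counting
  open Incidence {k}

  n : ℕ
  n = length (items k k 1)

  item : Fin n → Item k
  item = List.lookup (items k k 1)

  W : Fin n → ℕ
  W i = weight (item i)

  tags : List Tagged
  tags = symbols k

  proper : ∀ i → Proper k (item i)
  proper i = All.lookup (items-proper k 1) (∈-lookup i)

  block : Tagged → Subset n
  block j = Vec.tabulate (λ i → contains j (item i))

  ∈-block : ∀ i j → does (i ∈? block j) ≡ contains j (item i)
  ∈-block i j = trans (∈?-lookup i (block j)) (Vec.lookup∘tabulate _ i)

  subsetWeight : Subset n → ℕ
  subsetWeight p = ∑ (allFin n) (λ i → ⟦ does (i ∈? p) ⟧ * W i)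

  2*subsetWeight-block : ∀ j → proj₁ j < k → 2 * subsetWeight (block j) ≡ 3 * 1 * 2 ^ k
  2*subsetWeight-block j r<k = trans
    (cong (2 *_) (trans (∑-cong (allFin n) (λ i → cong (λ b → ⟦ b ⟧ * W i) (∈-block i j)))
      (∑-lookup (items k k 1) (λ it → ⟦ contains j it ⟧ * weight it))))
    (∑-contains k 1 (proj₂ j) r<k)

  -- The map from symbols to patterns is not assumed to be injective, so the fractional solution
  -- weights a subset by the number of symbols that have it as pattern.
  multiplicity : Subset n → ℕ
  multiplicity p = ∑ tags (λ j → ⟦ does (block j ≟ˢ p) ⟧)

  data Tag (p : Subset n) : Set where
    tag   : ∀ j → proj₁ j < k → block j ≡ p → Tag p
    none  : multiplicity p ≡ 0 → Tag p

  findTag : ∀ p → Tag p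
  findTag p = go (symbols-below k)
    where
    data Search (js : List Tagged) : Set where
      found   : ∀ j → proj₁ j < k → block j ≡ p → Search js
      missing : ∑ js (λ j → ⟦ does (block j ≟ˢ p) ⟧) ≡ 0 → Search js
    search : ∀ {js} → All (λ j → proj₁ j < k) js → Search js
    search []                       = missing refl
    search (_∷_ {x = j} r<k all) with block j ≟ˢ p in eq | search all
    ... | yes refl | _               = found j r<k refl
    ... | no _     | found j′ r<k′ q = found j′ r<k′ q
    ... | no _     | missing q       = missing (cong₂ (λ d m → ⟦ does d ⟧ + m) eq q)
    go : All (λ j → proj₁ j < k) tags → Tag p
    go all with search all
    ... | found j r<k q = tag j r<k q
    ... | missing q     = none q

  2*subsetWeight : ∀ p → multiplicity p ≢ 0 → 2 * subsetWeight p ≡ 3 * 2 ^ k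
  2*subsetWeight p m≢0 with findTag p
  ... | tag j r<k refl = 2*subsetWeight-block j r<k
  ... | none m≡0       = contradiction m≡0 m≢0

  -- All symbols with pattern q belong to every item of q, and an item has only two symbols. Summing
  -- over the items of q with their weights gives m * w ≤ 2 * w, and w ≠ 0 is cancelled without
  -- choosing an item.
  multiplicity≤2 : ∀ p → multiplicity p ≤ 2
  multiplicity≤2 p with findTag p
  ... | none m≡0       = ≤-trans (≤-reflexive m≡0) z≤n
  ... | tag j r<k refl = *-cancelʳ-≤ m 2 w {{≢-nonZero w≢0}} (begin
    m * w                                                    ≡⟨ ∑-* m (allFin n) _ ⟨
    ∑ (allFin n) (λ i → m * (⟦ does (i ∈? q) ⟧ * W i))        ≤⟨ ∑-mono (allFin n) pointwise ⟩
    ∑ (allFin n) (λ i → 2 * (⟦ does (i ∈? q) ⟧ * W i))        ≡⟨ ∑-* 2 (allFin n) _ ⟩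
    2 * w                                                    ∎)
    where
    open ≤-Reasoning
    q = block j
    m = multiplicity q
    w = subsetWeight q
    w≢0 : w ≢ 0
    w≢0 w≡0 = contradiction (trans (sym (2*subsetWeight-block j r<k)) (cong (2 *_) w≡0)) (positive (2 ^ k) (m^n>0 2 k))
      where
      positive : ∀ t → 0 < t → 3 * 1 * t ≢ 0
      positive (suc t) _ ()
    pointwise : ∀ i → m * (⟦ does (i ∈? q) ⟧ * W i) ≤ 2 * (⟦ does (i ∈? q) ⟧ * W i)
    pointwise i with does (i ∈? q) in i∈q
    ... | false = ≤-reflexive (*-zeroʳ m)
    ... | true  = *-monoˡ-≤ (1 * W i) (begin
      ∑ tags (λ j′ → ⟦ does (block j′ ≟ˢ q) ⟧)   ≤⟨ ∑-mono tags below ⟩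
      ∑ tags (λ j′ → ⟦ contains j′ (item i) ⟧)   ≡⟨ ∑-symbols k (item i) (proper i) ⟩
      2 ∎)
      where
      below : ∀ j′ → ⟦ does (block j′ ≟ˢ q) ⟧ ≤ ⟦ contains j′ (item i) ⟧
      below j′ with block j′ ≟ˢ q
      ... | no _   = z≤n
      ... | yes eq = ≤-reflexive (cong ⟦_⟧ (sym (trans (sym (∈-block i j′)) (trans (cong (λ p → does (i ∈? p)) eq) i∈q))))

  module _ {A : Set} (ps : List A) (set : A → Subset n) where

    -- The total weight counted by patterns and by items. Applied to x and to the multiplicities
    -- behind y, it makes the two objective values comparable item by item.
    double-count : ∀ Θ (f : A → ℕ) → (∀ p → f p ≢ 0 → subsetWeight (set p) ≡ Θ) →
      Θ * ∑ ps f ≡ ∑ (allFin n) (λ i → W i * ∑ (filter (λ p → i ∈? set p) ps) f)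
    double-count Θ f weight≡Θ = begin
      Θ * ∑ ps f                                             ≡⟨ ∑-* Θ ps f ⟨
      ∑ ps (λ p → Θ * f p)                                   ≡⟨ ∑-cong ps replace ⟩
      ∑ ps (λ p → f p * subsetWeight (set p))                ≡⟨ ∑-cong ps (λ p → ∑-* (f p) (allFin n) _) ⟨
      ∑ ps (λ p → ∑ (allFin n) (λ i → f p * (⟦ does (i ∈? set p) ⟧ * W i))) ≡⟨ ∑-swap ps (allFin n) _ ⟩
      ∑ (allFin n) (λ i → ∑ ps (λ p → f p * (⟦ does (i ∈? set p) ⟧ * W i))) ≡⟨ ∑-cong (allFin n) collect ⟩
      ∑ (allFin n) (λ i → W i * ∑ (filter (λ p → i ∈? set p) ps) f) ∎
      where
      open ≡-Reasoning
      replace : ∀ p → Θ * f p ≡ f p * subsetWeight (set p)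
      replace p with f p ℕ.≟ 0
      ... | yes f≡0 rewrite f≡0 = *-zeroʳ Θ
      ... | no  f≢0 = trans (*-comm Θ (f p)) (cong (f p *_) (sym (weight≡Θ p f≢0)))
      rearrange : ∀ a b c → a * (b * c) ≡ c * (b * a)
      rearrange = solve-∀
      collect : ∀ i → ∑ ps (λ p → f p * (⟦ does (i ∈? set p) ⟧ * W i)) ≡ W i * ∑ (filter (λ p → i ∈? set p) ps) f
      collect i = trans (∑-cong ps (λ p → rearrange (f p) ⟦ does (i ∈? set p) ⟧ (W i)))
        (trans (∑-* (W i) ps _) (cong (W i *_) (sym (∑-filter (λ p → i ∈? set p) ps f))))

    module Rounding (x : A → ℕ) (x-supported : ∀ p → x p ≢ 0 → multiplicity (set p) ≢ 0) where

      tagOf : ∀ p → Tag p → Tagged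
      tagOf p (tag j _ _) = j
      -- A default value: x vanishes on every subset that is not the pattern of a symbol, so it
      -- contributes nothing to `used`.
      tagOf p (none _)    = 0 , nothing

      -- Several symbols may have the same pattern, which is then charged to the one found by findTag.
      used : ℕ → Symbol k → ℕ
      used r s = ∑ ps (λ p → x p * agrees (tagOf (set p) (findTag (set p))) (r , s))

      -- A pattern in the support contains the item exactly if the symbol found for it is one of the
      -- two symbols of the item. This replaces patterns by symbols in condition (ii).
      ∑-patternsWith : ∀ i → ∑ (filter (λ p → i ∈? set p) ps) x
        ≡ used (proj₁ (item i)) (proj₁ (proj₂ (item i))) + used (proj₁ (item i)) (proj₂ (proj₂ (item i)))
      ∑-patternsWith i = begin
        ∑ (filter (λ p → i ∈? set p) ps) x            ≡⟨ ∑-filter (λ p → i ∈? set p) ps x ⟩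
        ∑ ps (λ p → ⟦ does (i ∈? set p) ⟧ * x p)       ≡⟨ ∑-cong ps split ⟩
        ∑ ps (λ p → x p * agrees (τ p) (r , s) + x p * agrees (τ p) (r , s′)) ≡⟨ ∑-+ ps _ _ ⟩
        used r s + used r s′ ∎
        where
        open ≡-Reasoning
        r = proj₁ (item i)
        s = proj₁ (proj₂ (item i))
        s′ = proj₂ (proj₂ (item i))
        τ : A → Tagged
        τ p = tagOf (set p) (findTag (set p))
        ∈-tag : ∀ q (t : Tag q) → multiplicity q ≢ 0 → does (i ∈? q) ≡ contains (tagOf q t) (item i)
        ∈-tag q (tag j _ refl) m≢0 = ∈-block i j
        ∈-tag q (none m≡0)     m≢0 = contradiction m≡0 m≢0
        split : ∀ p → ⟦ does (i ∈? set p) ⟧ * x p ≡ x p * agrees (τ p) (r , s) + x p * agrees (τ p) (r , s′)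
        split p with x p ℕ.≟ 0
        ... | yes x≡0 rewrite x≡0 = *-zeroʳ ⟦ does (i ∈? set p) ⟧
        ... | no  x≢0 = begin
          ⟦ does (i ∈? set p) ⟧ * x p      ≡⟨ *-comm _ (x p) ⟩
          x p * ⟦ does (i ∈? set p) ⟧      ≡⟨ cong (λ b → x p * ⟦ b ⟧) (∈-tag (set p) (findTag (set p)) (x-supported p x≢0)) ⟩
          x p * ⟦ contains (τ p) (item i) ⟧ ≡⟨ cong (x p *_) (contains-agrees (τ p) (proj₂ (proper i))) ⟩
          x p * (agrees (τ p) (r , s) + agrees (τ p) (r , s′)) ≡⟨ *-distribˡ-+ (x p) (agrees (τ p) (r , s)) _ ⟩
          x p * agrees (τ p) (r , s) + x p * agrees (τ p) (r , s′) ∎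

-- The lower bound in natural numbers.

module LowerBound (k : ℕ) (used : ℕ → Symbol k → ℕ) where
  open import Data.Integer.Base hiding (suc)
  open import Data.Integer.Properties
  open import Data.Integer.Tactic.RingSolver using (solve-∀)
  open LinearArithmetic
  open Discrepancy
  open Accounting {k}
  open Construction k
  open Incidence {k} using (weight)
  open Counting

  usage : Item k → ℕ
  usage (r , s , s′) = used r s ℕ.+ used r s′

  z : ℕ → Symbol k → ℤ
  z r s = + 2 * + used r s - 1ℤ

  z-odd : ∀ r s → Odd (z r s)
  z-odd r s = + used r s - 1ℤ , identity (+ used r s)
    where
    identity : ∀ x → + 2 * x - 1ℤ ≡ 1ℤ + + 2 * (x - 1ℤ)
    identity = solve-∀

  z≥-1 : ∀ r s → -1ℤ ≤ z r s
  z≥-1 r s = linear (2 ⊗ +≤+ (ℕ.z≤n {used r s})) (identity (+ used r s))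
    where
    identity : ∀ x → + 2 * x ≡ + 2 * x - 1ℤ - -1ℤ
    identity = solve-∀

  charge-usage : ∀ it → charge z it ≡ + 2 * + usage it - + 2
  charge-usage (r , s , s′) = trans (identity (+ used r s) (+ used r s′))
    (cong (λ t → + 2 * t - + 2) (sym (pos-+ (used r s) (used r s′))))
    where
    identity : ∀ x y → + 2 * x - 1ℤ + (+ 2 * y - 1ℤ) ≡ + 2 * (x + y) - + 2
    identity = solve-∀

  -- Hence a prefix has nonnegative gain exactly if its items are covered in number, each item of D
  -- counting once. In this way `Safe` expresses condition (ii).
  gain-usage : ∀ l → gain z l ≡ + 2 * (+ ∑ l (λ a → usage (proj₁ a) ℕ.+ proj₂ a) - + ∑ l (λ _ → 1))
  gain-usage []      = refl
  gain-usage (a ∷ l) = begin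
    charge z it + C + + 2 * (+ d + E)                    ≡⟨ cong (λ c → c + C + + 2 * (+ d + E)) (charge-usage it) ⟩
    + 2 * + usage it - + 2 + C + + 2 * (+ d + E)         ≡⟨ identity₁ (+ usage it) C (+ d) E ⟩
    + 2 * (+ usage it + + d - 1ℤ) + (C + + 2 * E)        ≡⟨ cong (_+_ (+ 2 * (+ usage it + + d - 1ℤ))) (gain-usage l) ⟩
    + 2 * (+ usage it + + d - 1ℤ) + + 2 * (+ G - + N)    ≡⟨ identity₂ (+ usage it) (+ d) (+ G) (+ N) ⟩
    + 2 * (+ usage it + + d + + G - (1ℤ + + N))          ∎
    where
    open ≡-Reasoning
    it = proj₁ a
    d = proj₂ a
    C E : ℤ
    C = charges z (map proj₁ l)
    E = labels l
    G = ∑ l (λ a → usage (proj₁ a) ℕ.+ proj₂ a)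
    N = ∑ l (λ _ → 1)
    identity₁ : ∀ u C d E → + 2 * u - + 2 + C + + 2 * (d + E) ≡ + 2 * (u + d - 1ℤ) + (C + + 2 * E)
    identity₁ = solve-∀
    identity₂ : ∀ u d G N → + 2 * (u + d - 1ℤ) + + 2 * (G - N) ≡ + 2 * (u + d + G - (1ℤ + N))
    identity₂ = solve-∀

  revenue : Item k × ℕ → ℕ
  revenue (it , d) = weight it ℕ.* (2 ℕ.* usage it ℕ.+ 4 ℕ.* d)

  -- For the list of all items, dividing by twice the common weight of the patterns turns this into
  -- the excess: usages become the value of x, labels become twice the total size of D, and the
  -- subtracted sum becomes the value of y.
  cost-usage : ∀ l → cost z l ≡ + ∑ l revenue - + ∑ l (λ a → weight (proj₁ a) ℕ.* 2)
  cost-usage []      = refl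
  cost-usage (a ∷ l) = begin
    + w * (charge z it + + 4 * + d) + cost z l               ≡⟨ cong₂ (λ c t → + w * (c + + 4 * + d) + t) (charge-usage it) (cost-usage l) ⟩
    + w * (+ 2 * + u - + 2 + + 4 * + d) + (+ R - + Q)        ≡⟨ identity (+ w) (+ u) (+ d) (+ R) (+ Q) ⟩
    + w * (+ 2 * + u + + 4 * + d) + + R - (+ w * + 2 + + Q)  ≡⟨ cong₂ (λ a b → a + + R - (b + + Q)) (sym pos-revenue) (sym (pos-* w 2)) ⟩
    + (revenue a ℕ.+ R) - + (w ℕ.* 2 ℕ.+ Q)                  ∎
    where
    open ≡-Reasoning
    it = proj₁ a
    d = proj₂ a
    w = weight it
    u = usage it
    R = ∑ l revenue
    Q = ∑ l (λ a → weight (proj₁ a) ℕ.* 2)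
    pos-revenue : + (w ℕ.* (2 ℕ.* u ℕ.+ 4 ℕ.* d)) ≡ + w * (+ 2 * + u + + 4 * + d)
    pos-revenue = trans (pos-* w (2 ℕ.* u ℕ.+ 4 ℕ.* d)) (cong (_*_ (+ w)) (cong₂ _+_ (pos-* 2 u) (pos-* 4 d)))
    identity : ∀ w u d R Q → w * (+ 2 * u - + 2 + + 4 * d) + (R - Q) ≡ w * (+ 2 * u + + 4 * d) + R - (w * + 2 + Q)
    identity = solve-∀

  module _ (D : Subset n)
    (covered : ∀ (u : Fin n → ℕ) → (∀ {i j} → i Fin.≤ j → u j ℕ.≤ u i) →
               ∑ (allFin n) u ℕ.≤ ∑ (allFin n) (λ i → u i ℕ.* (usage (item i) ℕ.+ ⟦ does (i ∈? D) ⟧)))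
    where

    label : Fin n → Item k × ℕ
    label i = item i , ⟦ does (i ∈? D) ⟧

    labelled : Labelled
    labelled = tabulate label

    labelled-items : map proj₁ labelled ≡ items k k 1
    labelled-items = trans (List.map-tabulate label proj₁) (List.tabulate-lookup (items k k 1))

    -- The covering inequality is applied to the indicator of the prefix, which is nonincreasing in
    -- the order of the items.
    labelled-safe : Safe z 0ℤ labelled
    labelled-safe l₁ l₂ eq = subst (0ℤ ≤_) (sym (trans (+-identityˡ (gain z l₁)) (gain-usage l₁)))
      (2 ⊗ gap (+≤+ count≤))
      where
      u : Fin n → ℕ
      u i = ⟦ toℕ i ℕ.<ᵇ length l₁ ⟧
      u-mono : ∀ {i j} → i Fin.≤ j → u j ℕ.≤ u i
      u-mono {i} {j} i≤j with toℕ j ℕ.<ᵇ length l₁ in eqj | toℕ i ℕ.<ᵇ length l₁ in eqi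
      ... | false | _     = ℕ.z≤n
      ... | true  | true  = ℕ.≤-refl
      ... | true  | false = contradiction
        (ℕ.<⇒<ᵇ (ℕ.≤-<-trans i≤j (ℕ.<ᵇ⇒< (toℕ j) (length l₁) (subst T (sym eqj) _))))
        (subst T eqi)
      count≤ : ∑ l₁ (λ _ → 1) ℕ.≤ ∑ l₁ (λ a → usage (proj₁ a) ℕ.+ proj₂ a)
      count≤ = subst₂ ℕ._≤_
        (trans (∑-cong (allFin n) (λ i → sym (ℕ.*-identityʳ (u i)))) (sym (∑-prefix label (λ _ → 1) l₁ l₂ eq)))
        (sym (∑-prefix label (λ a → usage (proj₁ a) ℕ.+ proj₂ a) l₁ l₂ eq))
        (covered u u-mono)

    -- The variable c stands for the numeral because 488 * t unfolds to 488 summands.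
    lower-bound : ∀ c → c ≡ 488 → 37 ℕ.≤ k →
      3 ℕ.* 2 ℕ.^ k ℕ.* (k ℕ.* k) ℕ.+ c ℕ.* ∑ (allFin n) (λ i → W i ℕ.* 2)
        ℕ.≤ c ℕ.* ∑ (allFin n) (λ i → W i ℕ.* (2 ℕ.* usage (item i) ℕ.+ 4 ℕ.* ⟦ does (i ∈? D) ⟧))
    lower-bound c c≡488 37≤k = subst₂ (λ Q R → 3 ℕ.* 2 ℕ.^ k ℕ.* (k ℕ.* k) ℕ.+ c ℕ.* Q ℕ.≤ c ℕ.* R)
      (∑-tabulate label (λ a → weight (proj₁ a) ℕ.* 2)) (∑-tabulate label revenue)
      (descend 3 (2 ℕ.^ k) (k ℕ.* k) c Q R
        (subst₂ (λ t c → + 3 * + (2 ℕ.^ k) * t + + c * + Q ≤ + c * + R) (sym (pos-* k k)) (sym c≡488)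
          (bound (+ k) (+ (2 ℕ.^ k)) (+ R) (+ Q) (cost z labelled)
            ((2 ℕ.^ k) ⊗ (k ⊗ gap (+≤+ 37≤k))) (≤-reflexive (cost-usage labelled))
            (cost-bound z z-odd z≥-1 k 1 labelled 0ℤ 0ℤ labelled-items ≤-refl labelled-safe))))
      where
      R Q : ℕ
      R = ∑ labelled revenue
      Q = ∑ labelled (λ a → weight (proj₁ a) ℕ.* 2)
      descend : ∀ a V K c Q R → + a * + V * + K + + c * + Q ≤ + c * + R → a ℕ.* V ℕ.* K ℕ.+ c ℕ.* Q ℕ.≤ c ℕ.* R
      descend a V K c Q R h = drop‿+≤+ (subst₂ _≤_ (sym left) (sym (pos-* c R)) h)
        where
        left : + (a ℕ.* V ℕ.* K ℕ.+ c ℕ.* Q) ≡ + a * + V * + K + + c * + Q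
        left = trans (pos-+ (a ℕ.* V ℕ.* K) (c ℕ.* Q)) (cong₂ _+_
          (trans (pos-* (a ℕ.* V) K) (cong (_* + K) (pos-* a V))) (pos-* c Q))
      -- The potential term is zero at the start of the list, and k ≥ 37 replaces 2 k - 37 by k.
      bound : ∀ k V R Q C → 0ℤ ≤ V * (k * (k - + 37)) → C ≤ R - Q →
        + 3 * (+ 2 * k - + 37) * k * + 1 * V ≤ + 488 * C + + 366 * (V * (0ℤ + + 4 * 0ℤ)) →
        + 3 * V * (k * k) + + 488 * Q ≤ + 488 * R
      bound k V R Q C k≥37 C≤R-Q h = linear (gap h ⊕ 3 ⊗ k≥37 ⊕ 488 ⊗ gap C≤R-Q) (identity k V R Q C)
        where
        identity : ∀ k V R Q C →
          + 488 * C + + 366 * (V * (0ℤ + + 4 * 0ℤ)) - + 3 * (+ 2 * k - + 37) * k * + 1 * V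
            + + 3 * (V * (k * (k - + 37))) + + 488 * (R - Q - C)
          ≡ + 488 * R - (+ 3 * V * (k * k) + + 488 * Q)
        identity = solve-∀

open import Data.Integer.Base using (+_)

-- Transfer from natural numbers to rationals.

module Rationals where
  open import Data.Rational.Base
  open import Data.Rational.Properties
  open import Data.Rational.Unnormalised.Base as ℚᵘ using (ℚᵘ; mkℚᵘ; *≡*; *≤*)
  import Data.Rational.Unnormalised.Properties as ℚᵘ

  fromℚᵘ-mono-≤ : ∀ {p q} → p ℚᵘ.≤ q → fromℚᵘ p ≤ fromℚᵘ q
  fromℚᵘ-mono-≤ {p} {q} p≤q = toℚᵘ-cancel-≤ (begin
    toℚᵘ (fromℚᵘ p) ≃⟨ toℚᵘ-fromℚᵘ p ⟩
    p               ≤⟨ p≤q ⟩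
    q               ≃⟨ toℚᵘ-fromℚᵘ q ⟨
    toℚᵘ (fromℚᵘ q) ∎)
    where open ℚᵘ.≤-Reasoning

  fromℚᵘ-homo-+ : ∀ p q → fromℚᵘ (p ℚᵘ.+ q) ≡ fromℚᵘ p + fromℚᵘ q
  fromℚᵘ-homo-+ p q = toℚᵘ-injective (begin-equality
    toℚᵘ (fromℚᵘ (p ℚᵘ.+ q))                ≃⟨ toℚᵘ-fromℚᵘ (p ℚᵘ.+ q) ⟩
    p ℚᵘ.+ q                                ≃⟨ ℚᵘ.+-cong (toℚᵘ-fromℚᵘ p) (toℚᵘ-fromℚᵘ q) ⟨
    toℚᵘ (fromℚᵘ p) ℚᵘ.+ toℚᵘ (fromℚᵘ q)     ≃⟨ toℚᵘ-homo-+ (fromℚᵘ p) (fromℚᵘ q) ⟨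
    toℚᵘ (fromℚᵘ p + fromℚᵘ q)              ∎)
    where open ℚᵘ.≤-Reasoning

  fromℚᵘ-homo-* : ∀ p q → fromℚᵘ (p ℚᵘ.* q) ≡ fromℚᵘ p * fromℚᵘ q
  fromℚᵘ-homo-* p q = toℚᵘ-injective (begin-equality
    toℚᵘ (fromℚᵘ (p ℚᵘ.* q))                ≃⟨ toℚᵘ-fromℚᵘ (p ℚᵘ.* q) ⟩
    p ℚᵘ.* q                                ≃⟨ ℚᵘ.*-cong (toℚᵘ-fromℚᵘ p) (toℚᵘ-fromℚᵘ q) ⟨
    toℚᵘ (fromℚᵘ p) ℚᵘ.* toℚᵘ (fromℚᵘ q)     ≃⟨ toℚᵘ-homo-* (fromℚᵘ p) (fromℚᵘ q) ⟨
    toℚᵘ (fromℚᵘ p * fromℚᵘ q)              ∎)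
    where open ℚᵘ.≤-Reasoning

  fromℕ-+ : ∀ m n → fromℕ (m ℕ.+ n) ≡ fromℕ m + fromℕ n
  fromℕ-+ m n = trans (fromℚᵘ-cong {mkℚᵘ (+ (m ℕ.+ n)) 0} {mkℚᵘ (+ m) 0 ℚᵘ.+ mkℚᵘ (+ n) 0} (*≡* (cong (ℤ._* + 1)
      (sym (cong₂ ℤ._+_ (ℤ.*-identityʳ (+ m)) (ℤ.*-identityʳ (+ n)))))))
    (fromℚᵘ-homo-+ (mkℚᵘ (+ m) 0) (mkℚᵘ (+ n) 0))

  fromℕ-* : ∀ m n → fromℕ (m ℕ.* n) ≡ fromℕ m * fromℕ n
  fromℕ-* m n = trans (fromℚᵘ-cong {mkℚᵘ (+ (m ℕ.* n)) 0} {mkℚᵘ (+ m) 0 ℚᵘ.* mkℚᵘ (+ n) 0} (*≡* (cong (ℤ._* + 1) (ℤ.pos-* m n))))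
    (fromℚᵘ-homo-* (mkℚᵘ (+ m) 0) (mkℚᵘ (+ n) 0))

  /≤fromℕ : ∀ a b m .{{_ : ℕ.NonZero b}} → a ℕ.≤ m ℕ.* b → + a / b ≤ fromℕ m
  /≤fromℕ a (suc b) m a≤mb = fromℚᵘ-mono-≤ {mkℚᵘ (+ a) b} {mkℚᵘ (+ m) 0} (*≤* (begin
    + a ℤ.* + 1       ≡⟨ ℤ.*-identityʳ (+ a) ⟩
    + a               ≤⟨ ℤ.+≤+ a≤mb ⟩
    + (m ℕ.* suc b)   ≡⟨ ℤ.pos-* m (suc b) ⟩
    + m ℤ.* + suc b   ∎))
    where open ℤ.≤-Reasoning

  0≤/ : ∀ a b .{{_ : ℕ.NonZero b}} → 0ℚ ≤ + a / b
  0≤/ a (suc b) = fromℚᵘ-mono-≤ {mkℚᵘ (+ 0) 0} {mkℚᵘ (+ a) b}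
    (*≤* (subst (+ 0 ℤ.≤_) (sym (ℤ.*-identityʳ (+ a))) (ℤ.+≤+ ℕ.z≤n)))

  fromℕ-mono-≤ : ∀ {m n} → m ℕ.≤ n → fromℕ m ≤ fromℕ n
  fromℕ-mono-≤ {m} {n} m≤n = /≤fromℕ m 1 n (ℕ.≤-trans m≤n (ℕ.≤-reflexive (sym (ℕ.*-identityʳ n))))

  fromℕ-*-inverse : ∀ m .{{_ : ℕ.NonZero m}} → fromℕ m * (+ 1 / m) ≡ 1ℚ
  fromℕ-*-inverse (suc m) = trans (sym (fromℚᵘ-homo-* (mkℚᵘ (+ suc m) 0) (mkℚᵘ (+ 1) m)))
    (fromℚᵘ-cong {mkℚᵘ (+ suc m) 0 ℚᵘ.* mkℚᵘ (+ 1) m} {mkℚᵘ (+ 1) 0} (*≡* (cong +_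
      (trans (ℕ.*-identityʳ _) (trans (ℕ.*-identityʳ (suc m)) (trans (sym (ℕ.+-identityʳ (suc m))) (sym (ℕ.+-identityʳ _))))))))

  sumℚ-scale : ∀ {A : Set} (f : A → ℕ) c xs → sumℚ (map (λ x → fromℕ (f x) * c) xs) ≡ fromℕ (∑ xs f) * c
  sumℚ-scale f c []       = sym (*-zeroˡ c)
  sumℚ-scale f c (x ∷ xs) = begin
    fromℕ (f x) * c + sumℚ (map (λ x → fromℕ (f x) * c) xs) ≡⟨ cong (_+_ (fromℕ (f x) * c)) (sumℚ-scale f c xs) ⟩
    fromℕ (f x) * c + fromℕ (∑ xs f) * c                    ≡⟨ *-distribʳ-+ c (fromℕ (f x)) (fromℕ (∑ xs f)) ⟨
    (fromℕ (f x) + fromℕ (∑ xs f)) * c                      ≡⟨ cong (_* c) (fromℕ-+ (f x) (∑ xs f)) ⟨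
    fromℕ (∑ (x ∷ xs) f) * c                                ∎
    where open ≡-Reasoning

  *-mono-≤-nonNeg : ∀ {p q r s} → 0ℚ ≤ r → 0ℚ ≤ q → p ≤ q → r ≤ s → p * r ≤ q * s
  *-mono-≤-nonNeg {p} {q} {r} {s} 0≤r 0≤q p≤q r≤s =
    ≤-trans (*-monoʳ-≤-nonNeg r {{nonNegative 0≤r}} p≤q) (*-monoˡ-≤-nonNeg q {{nonNegative 0≤q}} r≤s)

open import Data.Rational.Base using (ℚ; 0ℚ; 1ℚ; ½; _+_; _*_; _≤_; _<_; _/_)
import Data.Rational.Base as ℚ
import Data.Rational.Properties as ℚ
open import Data.Rational.Solver using (module +-*-Solver)

open Rationals

-- Division by c · a · θ, where ω and κ are the inverses of θ and c · a. The numbers enter only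
-- through equations, so the ring solver meets variables instead of large numerals. In the
-- application a = 2, b = 4 and c = 488, hence d = 1 / 488, e = ½ and f = 2.
divide-out : ∀ a b c d e f κ ω θ K C X D → 0ℚ ≤ κ → 0ℚ ≤ ω → θ * ω ≡ 1ℚ →
  a * κ ≡ d → c * κ ≡ e → c * a * κ ≡ 1ℚ → c * b * κ ≡ f →
  a * θ * K + c * (θ * C) ≤ c * (a * (θ * X) + b * D) →
  C * e + d * K ≤ X + f * (D * ω)
divide-out a b c d e f κ ω θ K C X D 0≤κ 0≤ω θω aκ cκ caκ cbκ h =
  subst₂ _≤_ left right (ℚ.*-monoʳ-≤-nonNeg κ {{ℚ.nonNegative 0≤κ}} (ℚ.*-monoʳ-≤-nonNeg ω {{ℚ.nonNegative 0≤ω}} h))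
  where
  open ≡-Reasoning
  open +-*-Solver
  left : (a * θ * K + c * (θ * C)) * ω * κ ≡ C * e + d * K
  left = begin
    (a * θ * K + c * (θ * C)) * ω * κ
      ≡⟨ solve 7 (λ a θ K c C ω κ → (a :* θ :* K :+ c :* (θ :* C)) :* ω :* κ
                    := (θ :* ω) :* (C :* (c :* κ)) :+ (θ :* ω) :* ((a :* κ) :* K)) refl a θ K c C ω κ ⟩
    (θ * ω) * (C * (c * κ)) + (θ * ω) * ((a * κ) * K)
      ≡⟨ cong₂ (λ t u → t * (C * u) + t * ((a * κ) * K)) θω cκ ⟩
    1ℚ * (C * e) + 1ℚ * ((a * κ) * K)
      ≡⟨ cong₂ _+_ (ℚ.*-identityˡ (C * e)) (trans (ℚ.*-identityˡ _) (cong (_* K) aκ)) ⟩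
    C * e + d * K ∎
  right : c * (a * (θ * X) + b * D) * ω * κ ≡ X + f * (D * ω)
  right = begin
    c * (a * (θ * X) + b * D) * ω * κ
      ≡⟨ solve 8 (λ a b θ X c D ω κ → c :* (a :* (θ :* X) :+ b :* D) :* ω :* κ
                    := (c :* a :* κ) :* ((θ :* ω) :* X) :+ (c :* b :* κ) :* (D :* ω)) refl a b θ X c D ω κ ⟩
    (c * a * κ) * ((θ * ω) * X) + (c * b * κ) * (D * ω)
      ≡⟨ cong₂ (λ t u → t * (u * X) + (c * b * κ) * (D * ω)) caκ θω ⟩
    1ℚ * (1ℚ * X) + (c * b * κ) * (D * ω)
      ≡⟨ cong₂ _+_ (trans (ℚ.*-identityˡ (1ℚ * X)) (ℚ.*-identityˡ X)) (cong (_* (D * ω)) cbκ) ⟩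
    X + f * (D * ω) ∎

fromℕ-weighted : ∀ a b c θ K C X D → a ℕ.* θ ℕ.* K ℕ.+ c ℕ.* (θ ℕ.* C) ℕ.≤ c ℕ.* (a ℕ.* (θ ℕ.* X) ℕ.+ b ℕ.* D) →
  fromℕ a * fromℕ θ * fromℕ K + fromℕ c * (fromℕ θ * fromℕ C)
    ≤ fromℕ c * (fromℕ a * (fromℕ θ * fromℕ X) + fromℕ b * fromℕ D)
fromℕ-weighted a b c θ K C X D h = subst₂ _≤_ left right (fromℕ-mono-≤ h)
  where
  left : fromℕ (a ℕ.* θ ℕ.* K ℕ.+ c ℕ.* (θ ℕ.* C)) ≡ fromℕ a * fromℕ θ * fromℕ K + fromℕ c * (fromℕ θ * fromℕ C)
  left = trans (fromℕ-+ (a ℕ.* θ ℕ.* K) (c ℕ.* (θ ℕ.* C))) (cong₂ _+_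
    (trans (fromℕ-* (a ℕ.* θ) K) (cong (_* fromℕ K) (fromℕ-* a θ)))
    (trans (fromℕ-* c (θ ℕ.* C)) (cong (fromℕ c *_) (fromℕ-* θ C))))
  right : fromℕ (c ℕ.* (a ℕ.* (θ ℕ.* X) ℕ.+ b ℕ.* D)) ≡ fromℕ c * (fromℕ a * (fromℕ θ * fromℕ X) + fromℕ b * fromℕ D)
  right = trans (fromℕ-* c _) (cong (fromℕ c *_) (trans (fromℕ-+ (a ℕ.* (θ ℕ.* X)) (b ℕ.* D)) (cong₂ _+_
    (trans (fromℕ-* a (θ ℕ.* X)) (cong (fromℕ a *_) (fromℕ-* θ X))) (fromℕ-* b D))))

-- 7808 = 16 · 488: the gap k² / 488 is compared with log₂ n ≤ 4 k.
c₀ : ℚ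
c₀ = + 1 / 7808

square-bound : ∀ k q → 0ℚ ≤ q → q ≤ fromℕ (4 ℕ.* k) → c₀ * (q * q) ≤ + 1 / 488 * fromℕ (k ℕ.* k)
square-bound k q 0≤q q≤4k = ℚ.≤-trans
  (ℚ.*-monoˡ-≤-nonNeg c₀ (*-mono-≤-nonNeg 0≤q (ℚ.≤-trans 0≤q q≤4k) q≤4k q≤4k))
  (ℚ.≤-reflexive (begin
    c₀ * (fromℕ (4 ℕ.* k) * fromℕ (4 ℕ.* k))        ≡⟨ cong (λ t → c₀ * (t * t)) (fromℕ-* 4 k) ⟩
    c₀ * ((fromℕ 4 * fromℕ k) * (fromℕ 4 * fromℕ k)) ≡⟨ regroup c₀ (fromℕ 4) (fromℕ k) ⟩
    c₀ * (fromℕ 4 * fromℕ 4) * (fromℕ k * fromℕ k)  ≡⟨ cong (c₀ * (fromℕ 4 * fromℕ 4) *_) (fromℕ-* k k) ⟨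
    + 1 / 488 * fromℕ (k ℕ.* k)                     ∎))
  where
  open ≡-Reasoning
  open +-*-Solver
  regroup : ∀ c a b → c * ((a * b) * (a * b)) ≡ c * (a * a) * (b * b)
  regroup = solve 3 (λ c a b → c :* ((a :* b) :* (a :* b)) := c :* (a :* a) :* (b :* b)) refl

weighted-bound : ∀ θ ω k C X D → 0ℚ ≤ ω → fromℕ θ * ω ≡ 1ℚ →
  (∀ c → c ≡ 488 → 2 ℕ.* θ ℕ.* (k ℕ.* k) ℕ.+ c ℕ.* (θ ℕ.* C) ℕ.≤ c ℕ.* (2 ℕ.* (θ ℕ.* X) ℕ.+ 4 ℕ.* D)) →
  fromℕ C * ½ + + 1 / 488 * fromℕ (k ℕ.* k) ≤ fromℕ X + fromℕ 2 * (fromℕ D * ω)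
weighted-bound θ ω k C X D 0≤ω θω h = go 2 4 488 refl refl refl refl (h 488 refl)
  where
  go : ∀ a b c → fromℕ a * (+ 1 / 976) ≡ + 1 / 488 → fromℕ c * (+ 1 / 976) ≡ ½ →
       fromℕ c * fromℕ a * (+ 1 / 976) ≡ 1ℚ → fromℕ c * fromℕ b * (+ 1 / 976) ≡ fromℕ 2 →
       a ℕ.* θ ℕ.* (k ℕ.* k) ℕ.+ c ℕ.* (θ ℕ.* C) ℕ.≤ c ℕ.* (a ℕ.* (θ ℕ.* X) ℕ.+ b ℕ.* D) →
       fromℕ C * ½ + + 1 / 488 * fromℕ (k ℕ.* k) ≤ fromℕ X + fromℕ 2 * (fromℕ D * ω)
  go a b c aκ cκ caκ cbκ h = divide-out (fromℕ a) (fromℕ b) (fromℕ c) (+ 1 / 488) ½ (fromℕ 2) (+ 1 / 976) ω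
    (fromℕ θ) (fromℕ (k ℕ.* k)) (fromℕ C) (fromℕ X) (fromℕ D) (0≤/ 1 976) 0≤ω θω aκ cκ caκ cbκ
    (fromℕ-weighted a b c θ (k ℕ.* k) C X D h)

-- The instance, the fractional solution and its gap.

module Solution (k Θ : ℕ) .{{_ : ℕ.NonZero Θ}} (2*Θ : 3 ℕ.* 2 ℕ.^ k ≡ 2 ℕ.* Θ) where
  open Counting
  open Rationals
  open Construction k
  open Incidence {k}

  ω : ℚ
  ω = + 1 / Θ

  Θω : fromℕ Θ * ω ≡ 1ℚ
  Θω = fromℕ-*-inverse Θ

  0≤ω : 0ℚ ≤ ω
  0≤ω = 0≤/ 1 Θ

  scale-mono : ∀ a b → a ℕ.≤ b → fromℕ a * ω ≤ fromℕ b * ω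
  scale-mono a b a≤b = ℚ.*-monoʳ-≤-nonNeg ω {{ℚ.nonNegative 0≤ω}} (fromℕ-mono-≤ {a} {b} a≤b)

  0<ω : 0ℚ < ω
  0<ω = ℚ.positive⁻¹ ω {{ℚ.normalize-pos 1 Θ}}

  I : Instance n
  I = record
    { size          = λ i → fromℕ (W i) * ω
    ; size-positive = λ i → ℚ.<-≤-trans (subst (0ℚ <_) (sym (ℚ.*-identityˡ ω)) 0<ω)
                              (scale-mono 1 (W i) (ℕ.m^n>0 2 (proj₁ (item i))))
    ; size≤1        = λ i → subst (fromℕ (W i) * ω ≤_) Θω (scale-mono (W i) Θ (W≤Θ i))
    ; nonincreasing = λ {i} {j} i≤j → scale-mono (W j) (W i) (ℕ.^-monoʳ-≤ 2 (lookup-descending (items-descending k 1) i≤j))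
    }
    where
    W≤Θ : ∀ i → W i ℕ.≤ Θ
    W≤Θ i = ℕ.*-cancelˡ-≤ 2 (begin
      2 ℕ.* 2 ℕ.^ proj₁ (item i) ≤⟨ ℕ.^-monoʳ-≤ 2 (proj₁ (proper i)) ⟩
      2 ℕ.^ k                    ≤⟨ ℕ.m≤m+n (2 ℕ.^ k) _ ⟩
      3 ℕ.* 2 ℕ.^ k              ≡⟨ 2*Θ ⟩
      2 ℕ.* Θ                    ∎)
      where open ℕ.≤-Reasoning

  open BinPacking I

  totalSize≡ : ∀ p → totalSize p ≡ fromℕ (subsetWeight p) * ω
  totalSize≡ p = trans (sumℚ-scale W ω (filter (_∈? p) (allFin n)))
    (cong (λ t → fromℕ t * ω) (∑-filter (_∈? p) (allFin n) W))

  halve : ∀ a → 2 ℕ.* a ≡ 3 ℕ.* 2 ℕ.^ k → a ≡ Θ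
  halve a 2*a = ℕ.*-cancelˡ-≡ a Θ 2 (trans 2*a 2*Θ)

  subsetWeight≡Θ : ∀ p → multiplicity p ≢ 0 → subsetWeight p ≡ Θ
  subsetWeight≡Θ p m≢0 = halve (subsetWeight p) (2*subsetWeight p m≢0)

  block-feasible : ∀ j → proj₁ j ℕ.< k → Feasible (block j)
  block-feasible j r<k = ℚ.≤-reflexive (trans (totalSize≡ (block j))
    (trans (cong (λ t → fromℕ t * ω) (halve (subsetWeight (block j)) (2*subsetWeight-block j r<k))) Θω))

  usages : Pattern → ℕ
  usages p = multiplicity (value p)

  y : Pattern → ℚ
  y p = fromℕ (usages p) * ½

  -- Multiplicities are expanded into symbols and the sums exchanged. Each symbol contributes only
  -- at its own pattern, which is feasible, so the sum counts the two symbols of the item, and y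
  -- covers every item with equality.
  ∑-usages : ∀ i → ∑ (patternsWith i) usages ≡ 2
  ∑-usages i = begin
    ∑ (patternsWith i) usages
      ≡⟨ ∑-filter (λ p → i ∈? value p) patterns usages ⟩
    ∑ patterns (λ p → ⟦ does (i ∈? value p) ⟧ ℕ.* usages p)
      ≡⟨ ∑-comprehension feasible? (subsets n) (λ p → ⟦ does (i ∈? p) ⟧ ℕ.* multiplicity p) ⟩
    ∑ (subsets n) (λ p → feasible p ℕ.* (⟦ does (i ∈? p) ⟧ ℕ.* multiplicity p))
      ≡⟨ ∑-cong (subsets n) expand ⟩
    ∑ (subsets n) (λ p → ∑ tags (λ j → feasible p ℕ.* ⟦ does (i ∈? p) ⟧ ℕ.* ⟦ does (block j ≟ˢ p) ⟧))
      ≡⟨ ∑-swap (subsets n) tags _ ⟩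
    ∑ tags (λ j → ∑ (subsets n) (λ p → feasible p ℕ.* ⟦ does (i ∈? p) ⟧ ℕ.* ⟦ does (block j ≟ˢ p) ⟧))
      ≡⟨ ∑-cong tags (λ j → trans (∑-cong (subsets n) (λ p → ℕ.*-comm (feasible p ℕ.* ⟦ does (i ∈? p) ⟧) _))
                              (∑-subsets n (block j) (λ p → feasible p ℕ.* ⟦ does (i ∈? p) ⟧))) ⟩
    ∑ tags (λ j → feasible (block j) ℕ.* ⟦ does (i ∈? block j) ⟧)
      ≡⟨ ∑-cong-All feasible-block (symbols-below k) ⟩
    ∑ tags (λ j → ⟦ contains j (item i) ⟧)
      ≡⟨ ∑-symbols k (item i) (proper i) ⟩
    2 ∎
    where
    open ≡-Reasoning
    feasible? : ∀ p → Dec (Feasible p)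
    feasible? p = totalSize p ℚ.≤? 1ℚ
    feasible : Subset n → ℕ
    feasible p = ⟦ does (feasible? p) ⟧
    expand : ∀ p → feasible p ℕ.* (⟦ does (i ∈? p) ⟧ ℕ.* multiplicity p) ≡
             ∑ tags (λ j → feasible p ℕ.* ⟦ does (i ∈? p) ⟧ ℕ.* ⟦ does (block j ≟ˢ p) ⟧)
    expand p = trans (sym (ℕ.*-assoc (feasible p) ⟦ does (i ∈? p) ⟧ (multiplicity p)))
      (sym (∑-* (feasible p ℕ.* ⟦ does (i ∈? p) ⟧) tags _))
    feasible-block : ∀ j → proj₁ j ℕ.< k → feasible (block j) ℕ.* ⟦ does (i ∈? block j) ⟧ ≡ ⟦ contains j (item i) ⟧
    feasible-block j r<k = trans
      (cong₂ ℕ._*_ (cong ⟦_⟧ (dec-true (feasible? (block j)) (block-feasible j r<k))) (cong ⟦_⟧ (∈-block i j)))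
      (ℕ.*-identityˡ _)

  half-mono : ∀ a b → a ℕ.≤ b → fromℕ a * ½ ≤ fromℕ b * ½
  half-mono a b a≤b = ℚ.*-monoʳ-≤-nonNeg ½ (fromℕ-mono-≤ {a} {b} a≤b)

  y≤1 : ∀ p → y p ≤ 1ℚ
  y≤1 p = half-mono (usages p) 2 (multiplicity≤2 (value p))

  y-solution : FractionalSolution y
  y-solution = record
    { nonnegative = λ p → half-mono 0 (usages p) ℕ.z≤n
    ; covers      = λ i → ℚ.≤-reflexive (sym (trans (sumℚ-scale usages ½ (patternsWith i))
                            (cong (λ t → fromℕ t * ½) (∑-usages i))))
    }

  n≤2^4k : 2 ℕ.≤ k → n ℕ.≤ 2 ℕ.^ (4 ℕ.* k)
  n≤2^4k 2≤k = begin
    n                                              ≤⟨ ℕ.m≤m+n n _ ⟩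
    n ℕ.+ 3 ℕ.* 1 ℕ.* 3 ℕ.^ k                       ≤⟨ length-items≤ k 1 ⟩
    3 ℕ.* 3 ℕ.^ k ℕ.* 2 ℕ.^ k                       ≤⟨ ℕ.*-monoˡ-≤ (2 ℕ.^ k) (ℕ.*-mono-≤ {3} {4} (ℕ.n≤1+n 3) (ℕ.^-monoˡ-≤ k (ℕ.n≤1+n 3))) ⟩
    2 ℕ.^ 2 ℕ.* 4 ℕ.^ k ℕ.* 2 ℕ.^ k                 ≡⟨ cong (λ t → 2 ℕ.^ 2 ℕ.* t ℕ.* 2 ℕ.^ k) (ℕ.^-*-assoc 2 2 k) ⟩
    2 ℕ.^ 2 ℕ.* 2 ℕ.^ (2 ℕ.* k) ℕ.* 2 ℕ.^ k         ≡⟨ cong (ℕ._* 2 ℕ.^ k) (ℕ.^-distribˡ-+-* 2 2 (2 ℕ.* k)) ⟨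
    2 ℕ.^ (2 ℕ.+ 2 ℕ.* k) ℕ.* 2 ℕ.^ k               ≡⟨ ℕ.^-distribˡ-+-* 2 (2 ℕ.+ 2 ℕ.* k) k ⟨
    2 ℕ.^ (2 ℕ.+ 2 ℕ.* k ℕ.+ k)                     ≤⟨ ℕ.^-monoʳ-≤ 2 (ℕ.+-monoˡ-≤ k (ℕ.+-monoˡ-≤ (2 ℕ.* k) 2≤k)) ⟩
    2 ℕ.^ (k ℕ.+ 2 ℕ.* k ℕ.+ k)                     ≡⟨ cong (2 ℕ.^_) (identity k) ⟩
    2 ℕ.^ (4 ℕ.* k)                                ∎
    where
    open ℕ.≤-Reasoning
    identity : ∀ k → k ℕ.+ 2 ℕ.* k ℕ.+ k ≡ 4 ℕ.* k
    identity = ℕ.solve-∀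

  -- Bounds every fraction a / b below log₂ n by 4 k, which is how log² n enters the encoded
  -- inequality.
  log-bound : 2 ℕ.≤ k → ∀ a b → 2 ℕ.^ a ℕ.≤ n ℕ.^ b → a ℕ.≤ 4 ℕ.* k ℕ.* b
  log-bound 2≤k a b 2^a≤n^b = ℕ.≮⇒≥ λ lt → ℕ.<⇒≱ (ℕ.^-monoʳ-< 2 (ℕ.s≤s (ℕ.s≤s ℕ.z≤n)) lt) (begin
    2 ℕ.^ a                   ≤⟨ 2^a≤n^b ⟩
    n ℕ.^ b                   ≤⟨ ℕ.^-monoˡ-≤ b (n≤2^4k 2≤k) ⟩
    (2 ℕ.^ (4 ℕ.* k)) ℕ.^ b   ≡⟨ ℕ.^-*-assoc 2 (4 ℕ.* k) b ⟩
    2 ℕ.^ (4 ℕ.* k ℕ.* b)     ∎)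
    where open ℕ.≤-Reasoning

  module _ (x : Pattern → ℕ) (D : Subset n) (supp : suppℕ x ⊆ suppℚ y)
           (σ : Complement D → Fin n) (σ≤ : ∀ j → σ j Fin.≤ value j)
           (σ⁻¹≤ : ∀ i → ∣ σ ⁻¹ i ∣ ℕ.≤ ∑ (patternsWith i) x) (37≤k : 37 ℕ.≤ k) where

    x-supported : ∀ p → x p ≢ 0 → usages p ≢ 0
    x-supported p x≢0 m≡0 = supp {p} x≢0 (cong (λ m → fromℕ m * ½) m≡0)

    open Rounding patterns value x x-supported using (used; ∑-patternsWith)
    open LowerBound k used using (usage; lower-bound)

    count : ∀ c → c ≡ 488 → 2 ℕ.* Θ ℕ.* (k ℕ.* k) ℕ.+ c ℕ.* (Θ ℕ.* ∑ patterns usages)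
            ℕ.≤ c ℕ.* (2 ℕ.* (Θ ℕ.* ∑ patterns x) ℕ.+ 4 ℕ.* subsetWeight D)
    count c c≡488 = reshape (3 ℕ.* 2 ℕ.^ k) (2 ℕ.* Θ)
      (∑ (allFin n) (λ i → W i ℕ.* 2)) (Θ ℕ.* ∑ patterns usages)
      (∑ (allFin n) (λ i → W i ℕ.* (2 ℕ.* usage (item i) ℕ.+ 4 ℕ.* ⟦ does (i ∈? D) ⟧)))
      (2 ℕ.* (Θ ℕ.* ∑ patterns x) ℕ.+ 4 ℕ.* subsetWeight D)
      2*Θ demand supply (lower-bound D covered c c≡488 37≤k)
      where
      reshape : ∀ a a′ b b′ e e′ → a ≡ a′ → b ≡ b′ → e ≡ e′ →
        a ℕ.* (k ℕ.* k) ℕ.+ c ℕ.* b ℕ.≤ c ℕ.* e → a′ ℕ.* (k ℕ.* k) ℕ.+ c ℕ.* b′ ℕ.≤ c ℕ.* e′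
      reshape a _ b _ e _ refl refl refl h = h
      covered : ∀ (u : Fin n → ℕ) → (∀ {i j} → i Fin.≤ j → u j ℕ.≤ u i) →
                ∑ (allFin n) u ℕ.≤ ∑ (allFin n) (λ i → u i ℕ.* (usage (item i) ℕ.+ ⟦ does (i ∈? D) ⟧))
      covered u u-mono = ℕ.≤-trans (cover D σ σ≤ (λ i → ∑ (patternsWith i) x) σ⁻¹≤ u u-mono)
        (ℕ.≤-reflexive (∑-cong (allFin n) (λ i → cong (λ t → u i ℕ.* (t ℕ.+ ⟦ does (i ∈? D) ⟧)) (∑-patternsWith i))))
      demand : ∑ (allFin n) (λ i → W i ℕ.* 2) ≡ Θ ℕ.* ∑ patterns usages
      demand = sym (trans (double-count patterns value Θ usages (λ p → subsetWeight≡Θ (value p)))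
        (∑-cong (allFin n) (λ i → cong (W i ℕ.*_) (∑-usages i))))
      supply : ∑ (allFin n) (λ i → W i ℕ.* (2 ℕ.* usage (item i) ℕ.+ 4 ℕ.* ⟦ does (i ∈? D) ⟧)) ≡
               2 ℕ.* (Θ ℕ.* ∑ patterns x) ℕ.+ 4 ℕ.* subsetWeight D
      supply = begin
        ∑ (allFin n) (λ i → W i ℕ.* (2 ℕ.* usage (item i) ℕ.+ 4 ℕ.* ⟦ does (i ∈? D) ⟧))
          ≡⟨ ∑-cong (allFin n) (λ i → identity (W i) (usage (item i)) ⟦ does (i ∈? D) ⟧) ⟩
        ∑ (allFin n) (λ i → 2 ℕ.* (W i ℕ.* usage (item i)) ℕ.+ 4 ℕ.* (⟦ does (i ∈? D) ⟧ ℕ.* W i))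
          ≡⟨ ∑-+ (allFin n) _ _ ⟩
        ∑ (allFin n) (λ i → 2 ℕ.* (W i ℕ.* usage (item i))) ℕ.+ ∑ (allFin n) (λ i → 4 ℕ.* (⟦ does (i ∈? D) ⟧ ℕ.* W i))
          ≡⟨ cong₂ ℕ._+_ (∑-* 2 (allFin n) _) (∑-* 4 (allFin n) _) ⟩
        2 ℕ.* ∑ (allFin n) (λ i → W i ℕ.* usage (item i)) ℕ.+ 4 ℕ.* subsetWeight D
          ≡⟨ cong (λ t → 2 ℕ.* t ℕ.+ 4 ℕ.* subsetWeight D) (∑-cong (allFin n) (λ i → cong (W i ℕ.*_) (sym (∑-patternsWith i)))) ⟩
        2 ℕ.* ∑ (allFin n) (λ i → W i ℕ.* ∑ (patternsWith i) x) ℕ.+ 4 ℕ.* subsetWeight D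
          ≡⟨ cong (λ t → 2 ℕ.* t ℕ.+ 4 ℕ.* subsetWeight D)
               (double-count patterns value Θ x (λ p x≢0 → subsetWeight≡Θ (value p) (x-supported p x≢0))) ⟨
        2 ℕ.* (Θ ℕ.* ∑ patterns x) ℕ.+ 4 ℕ.* subsetWeight D ∎
        where
        open ≡-Reasoning
        identity : ∀ w u d → w ℕ.* (2 ℕ.* u ℕ.+ 4 ℕ.* d) ≡ 2 ℕ.* (w ℕ.* u) ℕ.+ 4 ℕ.* (d ℕ.* w)
        identity = ℕ.solve-∀

    rounding-gap : (fromℕ (∑ patterns x) + fromℕ 2 * totalSize D) ≥ sumℚ (map y patterns) + c₀ ·log² n
    rounding-gap a b 2^a≤n^b = combine (fromℕ (∑ patterns usages) * ½) (sumℚ (map y patterns))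
      (c₀ * (q * q)) (+ 1 / 488 * fromℕ (k ℕ.* k)) (fromℕ (∑ patterns x)) (fromℕ (subsetWeight D) * ω) (totalSize D)
      (sumℚ-scale usages ½ patterns) (totalSize≡ D)
      (square-bound k q (0≤/ a b) (/≤fromℕ a b (4 ℕ.* k) (log-bound 2≤k a b 2^a≤n^b)))
      (weighted-bound Θ ω k (∑ patterns usages) (∑ patterns x) (subsetWeight D) 0≤ω Θω count)
      where
      q : ℚ
      q = + a / b
      2≤k : 2 ℕ.≤ k
      2≤k = ℕ.≤-trans (ℕ.s≤s (ℕ.s≤s ℕ.z≤n)) 37≤k
      combine : ∀ A A′ B B′ C E E′ → A′ ≡ A → E′ ≡ E → B ≤ B′ → A + B′ ≤ C + fromℕ 2 * E →
                A′ + B ≤ C + fromℕ 2 * E′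
      combine A _ B B′ C E _ refl refl B≤B′ h = ℚ.≤-trans (ℚ.+-monoʳ-≤ A B≤B′) h

-- Choice of the parameters.

LargeGap : ℕ → Set
LargeGap N = ∃[ n ] N ℕ.< n ×
    (Σ[ I ∈ Instance n ] let open BinPacking I in
    Σ[ y ∈ (Pattern → ℚ) ] FractionalSolution y × (∀ p → y p ≤ 1ℚ) ×
    (∀ (x : Pattern → ℕ) (D : Subset n) →
    suppℕ x ⊆ suppℚ y →
    (σ : Complement D → Fin n) →
    (∀ j → σ j Fin.≤ value j) →
    (∀ i → ∣ σ ⁻¹ i ∣ ℕ.≤ ∑ (patternsWith i) x) →
    (fromℕ (∑ patterns x) + fromℕ 2 * totalSize D)
    ≥ sumℚ (map y patterns) + c₀ ·log² n))

-- `Θ` is the common weight 3 · 2 ^ (k - 1) of all patterns, given by an equation that avoids the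
-- predecessor in the exponent.
largeGap : ∀ N k Θ .{{_ : ℕ.NonZero Θ}} → 3 ℕ.* 2 ℕ.^ k ≡ 2 ℕ.* Θ → 37 ℕ.≤ k → N ℕ.< k → LargeGap N
largeGap N k Θ 2*Θ 37≤k N<k =
  Construction.n k , ℕ.≤-trans N<k (Incidence.≤-length-items {k} k 1 ℕ.≤-refl) ,
  S.I , S.y , S.y-solution , S.y≤1 ,
  λ x D supp σ σ≤ σ⁻¹≤ → S.rounding-gap x D supp σ σ≤ σ⁻¹≤ 37≤k
  where module S = Solution k Θ 2*Θ

-- Stated for a variable h because 2 ^ (36 + N) would unfold to 2 ^ 36 summands.
largeGap-suc : ∀ N h → 36 ℕ.≤ h → N ℕ.≤ h → LargeGap N
largeGap-suc N h 36≤h N≤h =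
  largeGap N (suc h) (3 ℕ.* 2 ℕ.^ h) {{ℕ.m*n≢0 3 (2 ℕ.^ h) {{_}} {{ℕ.m^n≢0 2 h}}}}
    (double (2 ℕ.^ h)) (ℕ.s≤s 36≤h) (ℕ.s≤s N≤h)
  where
  double : ∀ V → 3 ℕ.* (2 ℕ.* V) ≡ 2 ℕ.* (3 ℕ.* V)
  double = ℕ.solve-∀

theorem2 : ∃[ c ] 0ℚ < c × (∀ (N : ℕ) → ∃[ n ] N ℕ.< n ×
    (Σ[ I ∈ Instance n ] let open BinPacking I in
    Σ[ y ∈ (Pattern → ℚ) ] FractionalSolution y × (∀ p → y p ≤ 1ℚ) ×
    (∀ (x : Pattern → ℕ) (D : Subset n) →
    suppℕ x ⊆ suppℚ y →
    (σ : Complement D → Fin n) →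
    (∀ j → σ j Fin.≤ value j) →
    (∀ i → ∣ σ ⁻¹ i ∣ ℕ.≤ sum (map x (patternsWith i))) →
    (fromℕ (sum (map x patterns)) + fromℕ 2 * totalSize D)
    ≥ sumℚ (map y patterns) + c ·log² n)))
theorem2 = c₀ , ℚ.positive⁻¹ c₀ , λ N → largeGap-suc N (36 ℕ.+ N) (ℕ.m≤m+n 36 N) (ℕ.m≤n+m N 36)
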